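{- Let $n$ be a natural number, let $q$ be a prime not dividing $n$, let $r$ be a power of a prime number $l$ not dividing $n$, and let $\chi:(\mathbb{Z}/q\mathbb{Z})^*\to\mu_r$ be a character. Let $\zeta_q,\zeta_r$ be primitive $q$-th and $r$-th roots of unity, $\tau(\chi)=-\sum_{x\in(\mathbb{Z}/q\mathbb{Z})^*}\zeta_q^x\chi(x)$ the Gaussian sum, and $\sigma_n$ the automorphism of $\mathbb{Q}(\zeta_q,\zeta_r)$ with $\sigma_n(\zeta_r)=\zeta_r^n$, $\sigma_n(\zeta_q)=\zeta_q$. Suppose that (1) for every prime $p$ dividing $n$ there exists $\lambda_p$ in the ring $\mathbb{Z}_l$ of $l$-adic integers with $p^{l-1}=n^{(l-1)\lambda_p}$ in $\mathbb{Z}_l^*$; (2) $\tau(\chi)^{\sigma_n-n}\in\langle\zeta_r\rangle$ in the ring $\mathbb{Z}[\zeta_q,\zeta_r]/(n)$, where $\langle\zeta_r\rangle$ denotes the cyclic subgroup of $(\mathbb{Z}[\zeta_q,\zeta_r]/(n))^*$ generated by the image of $\zeta_r$. Then $\chi(p)=\chi(n)^{\lambda_p}$ for every prime divisor $p$ of $n$.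
   Context: $\mu_r$ is the group of $r$-th roots of unity in $\overline{\mathbb{Q}}^*$. Exponential notation: $\tau^{\sigma_n-n}=\sigma_n(\tau)\tau^{ -n}$ (here $\tau(\chi)$ is a unit modulo $n$). Since $n^{l-1}$ and $p^{l-1}$ are $\equiv1\pmod l$, the power $n^{(l-1)\lambda_p}$ is defined in $\mathbb{Z}_l^*$; and for an $l$-power root of unity $\zeta$ and $\lambda\in\mathbb{Z}_l$, $\zeta^\lambda$ is defined via reduction of $\lambda$ modulo the order of $\zeta$. -}

module Defs where

open import Data.Nat as ℕ using (ℕ; zero; suc; _∸_)
open import Data.Nat.Divisibility as ℕD using (_∣?_)
open import Data.Nat.Primality using (Prime)
open import Data.Integer as ℤ using (ℤ; +_; -_; _+_; _-_; _*_; ∣_∣)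
open import Data.Integer.Divisibility as ℤD using ()
open import Data.Fin using (Fin; toℕ)
open import Data.Bool using (Bool; if_then_else_; _∧_)
open import Data.Product using (Σ; ∃; _×_)
open import Relation.Nullary.Decidable using (⌊_⌋)
open import Relation.Nullary using (¬_)
open import Relation.Binary.PropositionalEquality using (_≡_)

_≡_[mod_] : ℤ → ℤ → ℕ → Set
a ≡ b [mod m ] = (+ m) ℤD.∣ (a - b)

eqmod : ℕ → ℕ → ℕ → Bool
eqmod m a b = ⌊ m ∣? ∣ (+ a) - (+ b) ∣ ⌋

sumF : (n : ℕ) → (Fin n → ℤ) → ℤ
sumF zero    f = + 0
sumF (suc n) f = f Fin.zero + sumF n (λ i → f (Fin.suc i))

-- Characters  χ : (ℤ/qℤ)* → μ_r, written via exponents: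
-- χ(x) = ζ_r ^ (exp x).  (Values at multiples of q are irrelevant.)

record Character (q r : ℕ) : Set where
  field
    exp      : ℕ → ℕ
    periodic : ∀ x y → (+ x) ≡ (+ y) [mod q ] → (+ exp x) ≡ (+ exp y) [mod r ]
    mult     : ∀ x y → ¬ (q ℕD.∣ x) → ¬ (q ℕD.∣ y) →
               (+ exp (x ℕ.* y)) ≡ (+ exp x) + (+ exp y) [mod r ]

-- l-adic integers: compatible sequences  λ_k  (λ ≡ λ_k mod l^k)

record ℤ_ (l : ℕ) : Set where
  field
    approx  : ℕ → ℕ
    compat  : ∀ k → (+ approx (suc k)) ≡ (+ approx k) [mod l ℕ.^ k ]

open ℤ_ public

-- p^(l-1) = n^((l-1)λ) in ℤ_l^*  (the l-adic power n^((l-1)λ) is the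
-- limit of n^((l-1)λ_k); it is ≡ n^((l-1)λ_k) mod l^k)
LadicPowEq : (l p n : ℕ) → ℤ_ l → Set
LadicPowEq l p n λ' =
  ∀ k → (+ (p ℕ.^ (l ∸ 1))) ≡ (+ (n ℕ.^ ((l ∸ 1) ℕ.* approx λ' k))) [mod l ℕ.^ k ]

-- The group ring ℤ[C_q × C_r]  (X ↦ generator of C_q, Y ↦ generator of C_r),
-- elements as coefficient tables of X^i Y^j, i < q, j < r.

GR : ℕ → ℕ → Set
GR q r = Fin q → Fin r → ℤ

module _ {q r : ℕ} where

  _⊕_ : GR q r → GR q r → GR q r
  (f ⊕ g) i j = f i j + g i j

  _⊗_ : GR q r → GR q r → GR q r
  (f ⊗ g) i j =
    sumF q λ a → sumF r λ b → sumF q λ c → sumF r λ d →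
      if eqmod q (toℕ a ℕ.+ toℕ c) (toℕ i) ∧ eqmod r (toℕ b ℕ.+ toℕ d) (toℕ j)
      then f a b * g c d else + 0

  scal : ℤ → GR q r → GR q r
  scal z f i j = z * f i j

  neg : GR q r → GR q r
  neg f i j = - f i j

  mon : ℕ → ℕ → GR q r
  mon a b i j = if eqmod q a (toℕ i) ∧ eqmod r b (toℕ j) then + 1 else + 0

  one : GR q r
  one = mon 0 0

  _^ᴳ_ : GR q r → ℕ → GR q r
  f ^ᴳ zero  = one
  f ^ᴳ suc e = f ⊗ (f ^ᴳ e)

  σ : ℕ → GR q r → GR q r
  σ n f i j = sumF q λ a → sumF r λ b →
      if eqmod q (toℕ a) (toℕ i) ∧ eqmod r (n ℕ.* toℕ b) (toℕ j)
      then f a b else + 0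

-- Φ_q(X) = 1 + X + ... + X^(q-1)   (q prime)
ΦX : (q r : ℕ) → GR q r
ΦX q r i j = if eqmod r 0 (toℕ j) then + 1 else + 0

-- Φ_r(Y) for r = l^K:  Σ_{t<l} Y^(t l^(K-1)) if K ≥ 1,  Y - 1 if K = 0
ΦY : (q l K : ℕ) → GR q (l ℕ.^ K)
ΦY q l zero    = (mon 0 1) ⊕ neg (mon 0 0)
ΦY q l (suc K) = λ i j → sumF l λ t →
  if eqmod q 0 (toℕ i) ∧ eqmod (l ℕ.^ suc K) (toℕ t ℕ.* l ℕ.^ K) (toℕ j)
  then + 1 else + 0

-- Congruence in  ℤ[ζ_q, ζ_r]/(n) ≅ ℤ[C_q × C_r]/(n, Φ_q(X), Φ_r(Y)),  r = l^K
CongCyc : (n q l K : ℕ) → GR q (l ℕ.^ K) → GR q (l ℕ.^ K) → Set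
CongCyc n q l K f g =
  Σ (GR q (l ℕ.^ K)) λ a → Σ (GR q (l ℕ.^ K)) λ b → Σ (GR q (l ℕ.^ K)) λ c →
    ∀ i j → f i j - g i j
          ≡ (scal (+ n) a ⊕ ((ΦX q (l ℕ.^ K) ⊗ b) ⊕ (ΦY q l K ⊗ c))) i j

gauss : (q r : ℕ) → Character q r → GR q r
gauss q r χ i j = - (sumF q λ x →
  if eqmod q (toℕ x) 0 then + 0
  else mon {q} {r} (toℕ x) (Character.exp χ (toℕ x)) i j)

{-# OPTIONS --safe #-}
module Submission where

-- Fix a prime p dividing n and work in a nonzero quotient of ℤ[ζ_q,ζ_r]/(p). Let τ_a be the Gaussian sum with ζ_r replaced
-- by ζ_r^a. The Frobenius map gives τ_{pa} = χ(p)^{pa} τ_a^p, and hypothesis (2), conjugated, gives τ_{na} = ζ_r^{naj'} τ_a^n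
-- for a suitable j' that does not depend on p. Iterating, τ_{p^i} = χ(p)^{i p^i} τ_1^{p^i} and
-- τ_{n^i} = ζ_r^{i n^i j'} τ_1^{n^i}. For p^(l−1) and n^((l−1)m), with m close to λ_p, the two exponents of τ_1 agree
-- modulo a high power of l, while τ_1 has finite order modulo roots of unity; comparing the two expressions yields
-- χ(p) = ζ_r^{λ_p j'}. Only τ_1 ≠ 0 has to be known about τ_1: its p-power Frobenius iterates return to τ_1 up to a unit, so
-- it is then not nilpotent.
-- Multiplying over the prime factors of n gives χ(n) = ζ_r^{S j'} with n^{(l−1)S} = n^{l−1} in ℤ_l, where S is the sum of
-- the λ_p. As n^{l−1} > 1 has infinite multiplicative order, S = 1. Hence ζ_r^{j'} = χ(n) and χ(p) = χ(n)^{λ_p}.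

open import Defs
open import Algebra.Bundles using (CommutativeMonoid; CommutativeRing)
open import Algebra.Morphism.Structures using (module RingMorphisms)
import Algebra.Properties.Semiring.Mult as Mult
open import Data.Bool using (true; false; if_then_else_; _∧_)
open import Data.Fin using (Fin; zero; suc; toℕ; fromℕ; fromℕ<)
open import Data.Fin.Permutation using (Permutation; permutation)
open import Data.Fin.Properties using (pigeonhole; suc-injective; toℕ-fromℕ; toℕ-fromℕ<; toℕ-injective; toℕ<n)
open import Data.Integer as ℤ using (ℤ)
import Data.Integer.Divisibility.Signed as ℤS
import Data.Integer.Properties as ℤP
import Data.Integer.Tactic.RingSolver as ℤSolver
open import Data.List using ([]; _∷_)
open import Data.List.Relation.Unary.All using (All; []; _∷_)
open import Data.Nat as ℕ using (ℕ; zero; suc; NonZero; _∸_; s≤s; z≤n)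
open import Data.Nat.Combinatorics using (_C_; nCk≡nC[n∸k]; nCn≡1; nCk+nC[k+1]≡[n+1]C[k+1])
open import Data.Nat.Divisibility
open import Data.Nat.DivMod using (m≡m%n+[m/n]*n; m%n<n)
open import Data.Nat.ListAction using (product)
open import Data.Nat.Primality using (Prime; euclidsLemma; prime⇒irreducible; prime⇒nonTrivial; prime⇒nonZero)
open import Data.Nat.Primality.Factorisation using (factorise; PrimeFactorisation)
import Data.Nat.Properties as ℕP
import Data.Nat.Tactic.RingSolver as ℕSolver
open import Data.Product
open import Data.Sum using (_⊎_; inj₁; inj₂; [_,_]′)
open import Function using (_∘_)
open import Relation.Binary.PropositionalEquality as ≡ using (_≡_; _≢_)
open import Relation.Nullary


-- The quotient is not a field and `τ 1` cannot be divided out, so two substitutes for cancellation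
-- shape the proof. If a root of unity other than 1 fixed some power z of `τ 1`, every term of Φ_r
-- would act on z as the identity, whence l·z = 0 and z = 0, since l is invertible modulo p.
-- Likewise `τ 1` is only eventually periodic: its powers repeat from the exponent r on, and
-- comparisons are made after multiplying by its r-th power. The quotient is realised by shift
-- operators on integer grids modulo p, with equality tested on one grid. Thus τ_1 ≠ 0 amounts to
-- computing one coefficient, and no residue field with the required roots of unity has to be
-- constructed. Each p has its own ring; what leaves it is a congruence between exponents modulo r.
-- Results for different p can be combined because j' is computed from j and n alone. All l-adic
-- identities are used at a finite level, and each level must be chosen before the approximations
-- that it controls.

-- Congruences between natural numbers, and powers modulo prime powers

module Congruences where
  open import Data.Nat
  open import Data.Nat.Properties
  open ≡ using (refl; sym; trans; cong; cong₂; subst; module ≡-Reasoning)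

  -- A record, so that a and b can be recovered by unification.
  infix 4 _≋_⟨_⟩
  record _≋_⟨_⟩ (a b m : ℕ) : Set where
    constructor via
    field
      u v   : ℕ
      shift : a + u * m ≡ b + v * m

  ∣-∣-pos : ∀ {a b} → b ≤ a → ℤ.∣ (ℤ.+ a) ℤ.- (ℤ.+ b) ∣ ≡ a ∸ b
  ∣-∣-pos {a} {b} b≤a = cong ℤ.∣_∣ (trans (ℤP.[+m]-[+n]≡m⊖n a b) (ℤP.⊖-≥ b≤a))

  ∣-∣-neg : ∀ {a b} → a ≤ b → ℤ.∣ (ℤ.+ a) ℤ.- (ℤ.+ b) ∣ ≡ b ∸ a
  ∣-∣-neg {a} {b} a≤b = trans (cong ℤ.∣_∣ (ℤP.[+m]-[+n]≡m⊖n a b))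
    (trans (ℤP.∣m⊖n∣≡∣n⊖m∣ a b) (cong ℤ.∣_∣ (ℤP.⊖-≥ a≤b)))

  fromDiff : ∀ {a b m} → b ≤ a → m ∣ a ∸ b → a ≋ b ⟨ m ⟩
  fromDiff {a} {b} b≤a (divides k eq) =
    via 0 k (trans (+-identityʳ a) (trans (sym (m+[n∸m]≡n b≤a)) (cong (λ w → b + w) eq)))

  ≋-sym : ∀ {a b m} → a ≋ b ⟨ m ⟩ → b ≋ a ⟨ m ⟩
  ≋-sym (via u v e) = via v u (sym e)

  toDiff : ∀ {a b m} → b ≤ a → a ≋ b ⟨ m ⟩ → m ∣ a ∸ b
  toDiff {a} {b} {m} b≤a (via u v e) = ∣m+n∣m⇒∣n (subst (m ∣_) (+-cancelˡ-≡ b _ _ lem) (n∣m*n v)) (n∣m*n u)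
    where
    lem : b + v * m ≡ b + (u * m + (a ∸ b))
    lem = begin
      b + v * m              ≡⟨ sym e ⟩
      a + u * m              ≡⟨ cong (_+ u * m) (sym (m+[n∸m]≡n b≤a)) ⟩
      b + (a ∸ b) + u * m    ≡⟨ +-assoc b (a ∸ b) (u * m) ⟩
      b + ((a ∸ b) + u * m)  ≡⟨ cong (b +_) (+-comm (a ∸ b) (u * m)) ⟩
      b + (u * m + (a ∸ b))  ∎
      where open ≡-Reasoning

  fromℤ : ∀ {a b m} → (ℤ.+ a) ≡ (ℤ.+ b) [mod m ] → a ≋ b ⟨ m ⟩
  fromℤ {a} {b} {m} d with ≤-total b a
  ... | inj₁ b≤a = fromDiff b≤a (subst (m ∣_) (∣-∣-pos b≤a) d)
  ... | inj₂ a≤b = ≋-sym (fromDiff a≤b (subst (m ∣_) (∣-∣-neg a≤b) d))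

  toℤ : ∀ {a b m} → a ≋ b ⟨ m ⟩ → (ℤ.+ a) ≡ (ℤ.+ b) [mod m ]
  toℤ {a} {b} {m} c with ≤-total b a
  ... | inj₁ b≤a = subst (m ∣_) (sym (∣-∣-pos b≤a)) (toDiff b≤a c)
  ... | inj₂ a≤b = subst (m ∣_) (sym (∣-∣-neg a≤b)) (toDiff a≤b (≋-sym c))

  ≋-reflexive : ∀ {a b m} → a ≡ b → a ≋ b ⟨ m ⟩
  ≋-reflexive refl = via 0 0 refl

  ≋-refl : ∀ {a m} → a ≋ a ⟨ m ⟩
  ≋-refl = ≋-reflexive refl

  ≋-trans : ∀ {a b c m} → a ≋ b ⟨ m ⟩ → b ≋ c ⟨ m ⟩ → a ≋ c ⟨ m ⟩
  ≋-trans {a} {b} {c} {m} (via u v e) (via u′ v′ e′) = via (u + u′) (v + v′)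
    (trans (r₁ a u u′ m) (trans (cong (_+ u′ * m) e) (trans (r₂ b v u′ m)
      (trans (cong (_+ v * m) e′) (r₃ c v v′ m)))))
    where
    r₁ : ∀ a u u′ m → a + (u + u′) * m ≡ (a + u * m) + u′ * m
    r₁ = ℕSolver.solve-∀
    r₂ : ∀ b v u′ m → (b + v * m) + u′ * m ≡ (b + u′ * m) + v * m
    r₂ = ℕSolver.solve-∀
    r₃ : ∀ c v v′ m → (c + v′ * m) + v * m ≡ c + (v + v′) * m
    r₃ = ℕSolver.solve-∀

  +-≋ : ∀ {a b c d m} → a ≋ b ⟨ m ⟩ → c ≋ d ⟨ m ⟩ → a + c ≋ b + d ⟨ m ⟩
  +-≋ {a} {b} {c} {d} {m} (via u v e) (via u′ v′ e′) = via (u + u′) (v + v′)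
    (trans (r a c u u′ m) (trans (cong₂ _+_ e e′) (sym (r b d v v′ m))))
    where
    r : ∀ a c u u′ m → a + c + (u + u′) * m ≡ (a + u * m) + (c + u′ * m)
    r = ℕSolver.solve-∀

  *-≋ : ∀ {a b c d m} → a ≋ b ⟨ m ⟩ → c ≋ d ⟨ m ⟩ → a * c ≋ b * d ⟨ m ⟩
  *-≋ {a} {b} {c} {d} {m} (via u v e) (via u′ v′ e′) =
    via (a * u′ + u * c + u * u′ * m) (b * v′ + v * d + v * v′ * m)
    (trans (r a c u u′ m) (trans (cong₂ _*_ e e′) (sym (r b d v v′ m))))
    where
    r : ∀ a c u u′ m → a * c + (a * u′ + u * c + u * u′ * m) * m ≡ (a + u * m) * (c + u′ * m)
    r = ℕSolver.solve-∀

  *-≋ˡ : ∀ {a b c m} → a ≋ b ⟨ m ⟩ → a * c ≋ b * c ⟨ m ⟩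
  *-≋ˡ p = *-≋ p ≋-refl

  *-≋ʳ : ∀ a {b c m} → b ≋ c ⟨ m ⟩ → a * b ≋ a * c ⟨ m ⟩
  *-≋ʳ a p = *-≋ (≋-refl {a}) p

  ^-≋ : ∀ {a b m} k → a ≋ b ⟨ m ⟩ → a ^ k ≋ b ^ k ⟨ m ⟩
  ^-≋ zero    p = ≋-refl
  ^-≋ (suc k) p = *-≋ p (^-≋ k p)

  ≋-∣ : ∀ {a b m k} → k ∣ m → a ≋ b ⟨ m ⟩ → a ≋ b ⟨ k ⟩
  ≋-∣ {a} {b} {k = k} (divides q refl) (via u v e) = via (u * q) (v * q)
    (trans (cong (λ w → a + w) (*-assoc u q k)) (trans e (cong (λ w → b + w) (sym (*-assoc v q k)))))

  ∣⇒≋0 : ∀ {a m} → m ∣ a → a ≋ 0 ⟨ m ⟩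
  ∣⇒≋0 = fromDiff z≤n

  ≋0⇒∣ : ∀ {a m} → a ≋ 0 ⟨ m ⟩ → m ∣ a
  ≋0⇒∣ = toDiff z≤n

  %-≋ : ∀ a m .{{_ : NonZero m}} → a % m ≋ a ⟨ m ⟩
  %-≋ a m = via (a / m) 0 (trans (sym (m≡m%n+[m/n]*n a m)) (sym (+-identityʳ a)))

  ≋-resp-≡ : ∀ {a a′ b b′ m} → a ≡ a′ → b ≡ b′ → a ≋ b ⟨ m ⟩ → a′ ≋ b′ ⟨ m ⟩
  ≋-resp-≡ refl refl p = p

  -- Coprimality in the form that Euclid's lemma delivers; for m ≠ 0 it yields an inverse through
  -- `power≋1`.
  Cancellable : ℕ → ℕ → Set
  Cancellable m a = ∀ b → m ∣ a * b → m ∣ b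

  cancel-≋ : ∀ {a b c m} → Cancellable m c → c * a ≋ c * b ⟨ m ⟩ → a ≋ b ⟨ m ⟩
  cancel-≋ {a} {b} {c} {m} can p with ≤-total b a
  ... | inj₁ b≤a = fromDiff b≤a (can _ (subst (m ∣_) (sym (*-distribˡ-∸ c a b)) (toDiff (*-monoʳ-≤ c b≤a) p)))
  ... | inj₂ a≤b = ≋-sym (fromDiff a≤b (can _ (subst (m ∣_) (sym (*-distribˡ-∸ c b a)) (toDiff (*-monoʳ-≤ c a≤b) (≋-sym p)))))

  Cancellable-^ : ∀ {m a} k → Cancellable m a → Cancellable m (a ^ k)
  Cancellable-^ {m} zero    can b d = subst (m ∣_) (*-identityˡ b) d
  Cancellable-^ {m} {a} (suc k) can b d = Cancellable-^ k can b (can _ (subst (m ∣_) (*-assoc a (a ^ k) b) d))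

  prime-power-cancellable : ∀ {l a} → Prime l → ¬ l ∣ a → ∀ K → Cancellable (l ^ K) a
  prime-power-cancellable pl l∤a zero b _ = 1∣ b
  prime-power-cancellable {l} {a} pl l∤a (suc K) b d with euclidsLemma a b pl (∣-trans (m∣m*n (l ^ K)) d)
  ... | inj₁ l∣a = contradiction l∣a l∤a
  ... | inj₂ (divides b′ refl) = subst (l ^ suc K ∣_) (*-comm l b′)
        (*-monoʳ-∣ l (prime-power-cancellable pl l∤a K b′ (*-cancelˡ-∣ l (subst (l * l ^ K ∣_) r d))))
    where
    instance _ = prime⇒nonZero pl
    r : a * (b′ * l) ≡ l * (a * b′)
    r = trans (sym (*-assoc a b′ l)) (*-comm (a * b′) l)

  prime-cancellable : ∀ {l a} → Prime l → ¬ l ∣ a → Cancellable l a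
  prime-cancellable {l} {a} pl l∤a = subst (λ m → Cancellable m a) (*-identityʳ l) (prime-power-cancellable pl l∤a 1)

  -- Two of the m + 1 powers with exponents 0, ..., m share a residue; cancelling the smaller one
  -- leaves a positive exponent.
  power≋1 : ∀ {m a} .{{_ : NonZero m}} → Cancellable m a → ∃ λ h → a ^ suc h ≋ 1 ⟨ m ⟩
  power≋1 {m} {a} can with pigeonhole (n<1+n m) (λ i → fromℕ< (m%n<n (a ^ toℕ i) m))
  ... | i , j , i<j , eq = h , cancel-≋ {c = a ^ toℕ i} (Cancellable-^ {m} {a} (toℕ i) can)
          (≋-resp-≡ aʲ (sym (*-identityʳ (a ^ toℕ i))) (≋-sym aⁱ≋aʲ))
    where
    h = toℕ j ∸ suc (toℕ i)
    aʲ : a ^ toℕ j ≡ a ^ toℕ i * a ^ suc h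
    aʲ = trans (cong (a ^_) (trans (sym (m+[n∸m]≡n i<j)) (sym (+-suc (toℕ i) h)))) (^-distribˡ-+-* a (toℕ i) (suc h))
    residues : (a ^ toℕ i) % m ≡ (a ^ toℕ j) % m
    residues = trans (sym (toℕ-fromℕ< (m%n<n (a ^ toℕ i) m))) (trans (cong toℕ eq) (toℕ-fromℕ< (m%n<n (a ^ toℕ j) m)))
    aⁱ≋aʲ : a ^ toℕ i ≋ a ^ toℕ j ⟨ m ⟩
    aⁱ≋aʲ = ≋-trans (≋-sym (%-≋ _ m)) (≋-trans (≋-reflexive residues) (%-≋ _ m))

  inverse-mod : ∀ {m a} .{{_ : NonZero m}} → Cancellable m a → ∃ λ b → a * b ≋ 1 ⟨ m ⟩
  inverse-mod {m} {a} can with power≋1 {m} {a} can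
  ... | h , p = a ^ h , p

  prime>1 : ∀ {p} → Prime p → 1 < p
  prime>1 pp = nonTrivial⇒n>1 _ {{prime⇒nonTrivial pp}}

  split-power : ∀ {l} → Prime l → ∀ m → 0 < m → ∃₂ λ t u → (m ≡ l ^ t * u) × (¬ l ∣ u)
  split-power {l} pl m m>0 = go m m ≤-refl m>0
    where
    instance _ = prime⇒nonZero pl
    go : ∀ fuel m → m ≤ fuel → 0 < m → ∃₂ λ t u → (m ≡ l ^ t * u) × (¬ l ∣ u)
    go zero _ z≤n ()
    go (suc fuel) m m≤ m>0 with l ∣? m
    ... | no l∤m = 0 , m , sym (*-identityˡ m) , l∤m
    ... | yes (divides zero refl) = contradiction m>0 λ ()
    ... | yes (divides m′@(suc _) refl) with go fuel m′ (s≤s⁻¹ (<-≤-trans (m<m*n m′ l (prime>1 pl)) m≤)) z<s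
    ...   | t , u , eq , l∤u = suc t , u ,
            trans (*-comm m′ l) (trans (cong (l *_) eq) (sym (*-assoc l (l ^ t) u))) , l∤u

  -- The sum 1 + g + ⋯ + g^(w-1) in Horner form.
  geometric : ℕ → ℕ → ℕ
  geometric g zero    = 0
  geometric g (suc w) = 1 + g * geometric g w

  geometric-telescopes : ∀ d w → suc (d * geometric (suc d) w) ≡ suc d ^ w
  geometric-telescopes d zero    = cong suc (*-zeroʳ d)
  geometric-telescopes d (suc w) = trans (r d (geometric (suc d) w)) (cong (suc d *_) (geometric-telescopes d w))
    where
    r : ∀ d x → suc (d * suc (suc d * x)) ≡ suc d * suc (d * x)
    r = ℕSolver.solve-∀

  geometric-≋ : ∀ {g m} → g ≋ 1 ⟨ m ⟩ → ∀ w → geometric g w ≋ w ⟨ m ⟩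
  geometric-≋ p zero    = ≋-refl
  geometric-≋ p (suc w) = +-≋ (≋-refl {1}) (≋-trans (*-≋ p (geometric-≋ p w)) (≋-reflexive (*-identityˡ w)))

  -- g^w − 1 = (g − 1)(1 + g + ⋯ + g^(w−1)), and the second factor is ≡ w modulo l.
  unit-root : ∀ {l g w} k → Prime l → 0 < g → g ≋ 1 ⟨ l ⟩ → ¬ l ∣ w →
              g ^ w ≋ 1 ⟨ l ^ k ⟩ → g ≋ 1 ⟨ l ^ k ⟩
  unit-root {l} {suc d} {w} k pl _ g≋1 l∤w gʷ≋1 = fromDiff (s≤s z≤n)
    (prime-power-cancellable pl l∤geo k d
      (subst (l ^ k ∣_) (*-comm d _)
        (toDiff (s≤s z≤n) (subst (λ x → x ≋ 1 ⟨ l ^ k ⟩) (sym (geometric-telescopes d w)) gʷ≋1))))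
    where
    l∤geo : ¬ l ∣ geometric (suc d) w
    l∤geo l∣ = l∤w (≋0⇒∣ (≋-trans (≋-sym (geometric-≋ g≋1 w)) (∣⇒≋0 l∣)))

  ^-mono-∣ : ∀ l {m n} → m ≤ n → l ^ m ∣ l ^ n
  ^-mono-∣ l {m} {n} m≤n = subst (l ^ m ∣_)
    (trans (sym (^-distribˡ-+-* l m (n ∸ m))) (cong (l ^_) (m+[n∸m]≡n m≤n))) (m∣m*n _)

  n<m^n : ∀ {m} → 1 < m → ∀ n → n < m ^ n
  n<m^n 1<m zero    = s≤s z≤n
  n<m^n {m} 1<m (suc n) = <-≤-trans (s≤s (n<m^n 1<m n)) (≤-trans (m<m*n (m ^ n) m 1<m) (≤-reflexive (*-comm (m ^ n) m)))
    where instance _ = m^n≢0 m n {{>-nonZero (<-trans z<s 1<m)}}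

  -- Were l^K ∤ v, a bounded power of g would be ≡ 1 modulo l^k, impossible once l^k exceeds that power.
  order-unbounded : ∀ {l g} → Prime l → ¬ l ∣ g → 1 < g → ∀ K →
    ∃ λ k → K ≤ k × (∀ v → g ^ v ≋ 1 ⟨ l ^ k ⟩ → l ^ K ∣ v)
  order-unbounded {l} {g} pl l∤g 1<g K = k , m≤m+n K _ , λ { zero _ → (l ^ K) ∣0 ; v@(suc _) → claim v z<s }
    where
    instance _ = prime⇒nonZero pl
    instance _ = >-nonZero (<-trans z<s 1<g)
    h = suc (proj₁ (power≋1 {l} {g} (prime-cancellable pl l∤g)))
    gʰ≋1 : g ^ h ≋ 1 ⟨ l ⟩
    gʰ≋1 = proj₂ (power≋1 {l} {g} (prime-cancellable pl l∤g))
    -- The second summand makes l^k exceed g^(h·l^s) for every s < K. The factor h brings the base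
    -- to 1 modulo l, which lets `unit-root` strip the part of v prime to l.
    k = K + g ^ (h * l ^ K)
    claim : ∀ v → 0 < v → g ^ v ≋ 1 ⟨ l ^ k ⟩ → l ^ K ∣ v
    claim v 0<v gᵛ≋1 with split-power pl v 0<v
    ... | s , w , refl , l∤w with K ≤? s
    ...   | yes K≤s = ∣-trans (^-mono-∣ l K≤s) (m∣m*n w)
    ...   | no K≰s = contradiction (≤-trans (∣⇒≤ {{>-nonZero (m<n⇒0<n∸m 1<G)}} (toDiff (<⇒≤ 1<G) G≋1)) (m∸n≤m G 1)) (<⇒≱ G<)
      where
      G = g ^ (h * l ^ s)
      instance _ = m^n≢0 l s
      instance _ = m*n≢0 h (l ^ s)
      1<G : 1 < G
      1<G = ≤-trans 1<g (≤-trans (≤-reflexive (sym (*-identityʳ g))) (^-monoʳ-≤ g {1} (>-nonZero⁻¹ (h * l ^ s))))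
      G< : G < l ^ k
      G< = ≤-<-trans (^-monoʳ-≤ g (*-monoʳ-≤ h (^-monoʳ-≤ l (<⇒≤ (≰⇒> K≰s))))) (≤-<-trans (m≤n+m _ K) (n<m^n (prime>1 pl) k))
      G≋1 : G ≋ 1 ⟨ l ^ k ⟩
      G≋1 = unit-root k pl (<-trans z<s 1<G)
        (subst (λ x → x ≋ 1 ⟨ l ⟩) (^-*-assoc g h (l ^ s)) (≋-trans (^-≋ (l ^ s) gʰ≋1) (≋-reflexive (^-zeroˡ (l ^ s)))))
        l∤w
        (subst (λ x → x ≋ 1 ⟨ l ^ k ⟩) (trans (^-*-assoc g (l ^ s * w) h) (trans (cong (g ^_) (r (l ^ s) w h)) (sym (^-*-assoc g (h * l ^ s) w))))
          (≋-trans (^-≋ h gᵛ≋1) (≋-reflexive (^-zeroˡ h))))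
        where
        r : ∀ a w h → a * w * h ≡ h * a * w
        r = ℕSolver.solve-∀

  -- The precision k has to be fixed before S exists, because S will be a sum of approximations
  -- taken at level k. If S = 0, then g ≡ 1, and `ord` at the exponent 1 forces l^K to divide 1.
  fixed-power : ∀ {l g} → Prime l → ¬ l ∣ g → 1 < g → ∀ K →
    ∃ λ k → K ≤ k × (∀ S → g ^ S ≋ g ⟨ l ^ k ⟩ → S ≋ 1 ⟨ l ^ K ⟩)
  fixed-power {l} {g} pl l∤g 1<g K with order-unbounded pl l∤g 1<g K
  ... | k , K≤k , ord = k , K≤k , λ where
    zero    p → ≋-sym (∣⇒≋0 (ord 1 (≋-trans (≋-reflexive (*-identityʳ g)) (≋-sym p))))
    (suc s) p → fromDiff (s≤s z≤n) (ord s (cancel-≋ {c = g} (prime-power-cancellable pl l∤g k)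
                  (≋-trans p (≋-reflexive (sym (*-identityʳ g))))))

open Congruences

-- Residues

-- Carrying the Boolean value beside the decision lets `rewrite` resolve the conditionals in the
-- coefficient tables.
≋? : ∀ a b m → (a ≋ b ⟨ m ⟩ × eqmod m a b ≡ true) ⊎ (¬ a ≋ b ⟨ m ⟩ × eqmod m a b ≡ false)
≋? a b m with m ∣? ℤ.∣ (ℤ.+ a) ℤ.- (ℤ.+ b) ∣
... | yes d = inj₁ (fromℤ d , ≡.refl)
... | no ¬d = inj₂ ((λ c → ¬d (toℤ c)) , ≡.refl)

residue-unique : ∀ {m a b} → a ℕ.< m → b ℕ.< m → a ≋ b ⟨ m ⟩ → a ≡ b
residue-unique {m} {a} {b} a<m b<m p = [ (λ b≤a → go b≤a a<m p) , (λ a≤b → ≡.sym (go a≤b b<m (≋-sym p))) ]′ (ℕP.≤-total b a)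
  where
  go : ∀ {a b} → b ℕ.≤ a → a ℕ.< m → a ≋ b ⟨ m ⟩ → a ≡ b
  go {a} {b} b≤a a<m p with a ∸ b in eq | toDiff b≤a p
  ... | zero  | _ = ℕP.≤-antisym (ℕP.m∸n≡0⇒m≤n eq) b≤a
  ... | suc _ | d = contradiction (ℕP.≤-trans (∣⇒≤ d) (ℕP.≤-trans (ℕP.≤-reflexive (≡.sym eq)) (ℕP.m∸n≤m a b))) (ℕP.<⇒≱ a<m)

residue : ℕ → (m : ℕ) .{{_ : NonZero m}} → Fin m
residue a m = fromℕ< (m%n<n a m)

residue-≋ : ∀ a m .{{_ : NonZero m}} → toℕ (residue a m) ≋ a ⟨ m ⟩
residue-≋ a m = ≋-trans (≋-reflexive (toℕ-fromℕ< (m%n<n a m))) (%-≋ a m)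

≋-toℕ : ∀ {m} {i j : Fin m} → toℕ i ≋ toℕ j ⟨ m ⟩ → i ≡ j
≋-toℕ {m} {i} {j} p = toℕ-injective (residue-unique (toℕ<n i) (toℕ<n j) p)

multiplication : ∀ {m} a b .{{_ : NonZero m}} → a ℕ.* b ≋ 1 ⟨ m ⟩ → Permutation m m
multiplication {m} a b ab≋1 = permutation (by a) (by b) (inv a b ab≋1) (inv b a (≋-trans (≋-reflexive (ℕP.*-comm b a)) ab≋1))
  where
  by : ℕ → Fin m → Fin m
  by a i = residue (a ℕ.* toℕ i) m
  inv : ∀ a b → a ℕ.* b ≋ 1 ⟨ m ⟩ → ∀ i → by a (by b i) ≡ i
  inv a b ab≋1 i = ≋-toℕ
    (≋-trans (residue-≋ (a ℕ.* toℕ (by b i)) m) (≋-trans (*-≋ʳ a (residue-≋ (b ℕ.* toℕ i) m))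
      (≋-trans (≋-reflexive (≡.sym (ℕP.*-assoc a b (toℕ i)))) (≋-trans (*-≋ˡ ab≋1) (≋-reflexive (ℕP.*-identityˡ (toℕ i)))))))

-- Binomial coefficients modulo a prime

nC0≡1 : ∀ n → n C 0 ≡ 1
nC0≡1 n = ≡.trans (nCk≡nC[n∸k] {0} {n} z≤n) (nCn≡1 n)

absorption : ∀ n k → suc k ℕ.* (suc n C suc k) ≡ suc n ℕ.* (n C k)
absorption zero    zero    = ≡.refl
absorption zero    (suc k) = ℕP.*-zeroʳ k
absorption (suc n) zero    = ≡.trans (≡.cong (1 ℕ.*_) (≡.sym (nCk+nC[k+1]≡[n+1]C[k+1] (suc n) 0)))
  (≡.trans (ℕP.*-identityˡ _) (≡.trans (≡.cong (λ w → 1 ℕ.+ w) (≡.trans (≡.sym (ℕP.*-identityˡ _)) (absorption n 0))) (r (suc n))))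
  where
  r : ∀ n → 1 ℕ.+ n ℕ.* 1 ≡ suc n ℕ.* 1
  r = ℕSolver.solve-∀
absorption (suc n) (suc k) = begin
  suc (suc k) ℕ.* (suc (suc n) C suc (suc k))
    ≡⟨ ≡.cong (suc (suc k) ℕ.*_) (≡.sym (nCk+nC[k+1]≡[n+1]C[k+1] (suc n) (suc k))) ⟩
  suc (suc k) ℕ.* (A ℕ.+ B)                                 ≡⟨ r₁ k A B ⟩
  suc k ℕ.* A ℕ.+ suc (suc k) ℕ.* B ℕ.+ A                   ≡⟨ ≡.cong (ℕ._+ A) (≡.cong₂ ℕ._+_ (absorption n k) (absorption n (suc k))) ⟩
  suc n ℕ.* (n C k) ℕ.+ suc n ℕ.* (n C suc k) ℕ.+ A         ≡⟨ ≡.cong (ℕ._+ A) (≡.sym (ℕP.*-distribˡ-+ (suc n) (n C k) (n C suc k))) ⟩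
  suc n ℕ.* (n C k ℕ.+ n C suc k) ℕ.+ A                     ≡⟨ ≡.cong (λ w → suc n ℕ.* w ℕ.+ A) (nCk+nC[k+1]≡[n+1]C[k+1] n k) ⟩
  suc n ℕ.* A ℕ.+ A                                         ≡⟨ ℕP.+-comm _ A ⟩
  suc (suc n) ℕ.* A                                         ∎
  where
  open ≡.≡-Reasoning
  A = suc n C suc k
  B = suc n C suc (suc k)
  r₁ : ∀ k a b → suc (suc k) ℕ.* (a ℕ.+ b) ≡ suc k ℕ.* a ℕ.+ suc (suc k) ℕ.* b ℕ.+ a
  r₁ = ℕSolver.solve-∀

-- In k·C(p,k) = p·C(p-1,k-1) the prime p divides the right-hand side but not k.
prime∣binomial : ∀ {p k} → Prime p → 0 ℕ.< k → k ℕ.< p → p ∣ p C k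
prime∣binomial {suc n} {suc k} pp _ k<p with euclidsLemma (suc k) (suc n C suc k) pp
    (≡.subst (suc n ∣_) (≡.sym (absorption n k)) (m∣m*n (n C k)))
... | inj₁ p∣k = contradiction (∣⇒≤ p∣k) (ℕP.<⇒≱ k<p)
... | inj₂ p∣C = p∣C

-- Finite sums over residues

module FiniteSums {c ℓ} (M : CommutativeMonoid c ℓ) where
  open CommutativeMonoid M renaming (_∙_ to _+_; ε to 0#; identityˡ to +-identityˡ; identityʳ to +-identityʳ; ∙-cong to +-cong)
  open import Algebra.Properties.CommutativeMonoid.Sum M public

  Periodic : ℕ → (ℕ → Carrier) → Set ℓ
  Periodic m g = ∀ {a b} → a ≋ b ⟨ m ⟩ → g a ≈ g b

  sum-zero : ∀ {n} {f : Fin n → Carrier} → (∀ i → f i ≈ 0#) → sum f ≈ 0#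
  sum-zero {n} f≈0 = trans (sum-cong-≋ f≈0) (sum-replicate-zero n)

  sum-single : ∀ {n} {f : Fin n → Carrier} k → (∀ i → i ≢ k → f i ≈ 0#) → sum f ≈ f k
  sum-single zero    f≈0 = trans (+-cong refl (sum-zero (λ i → f≈0 (suc i) λ ()))) (+-identityʳ _)
  sum-single (suc k) f≈0 = trans (+-cong (f≈0 zero λ ()) (sum-single k (λ i i≢k → f≈0 (suc i) (i≢k ∘ suc-injective)))) (+-identityˡ _)

  -- The index `c` need not be reduced: the surviving index is its residue, and periodicity carries
  -- the value back to `c`.
  sum-δ : ∀ {m} .{{_ : NonZero m}} {g} → Periodic m g → ∀ c →
          ∑[ i < m ] (if eqmod m c (toℕ i) then g (toℕ i) else 0#) ≈ g c
  sum-δ {m} {g} per c = trans (sum-single k off) on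
    where
    k = residue c m
    on : (if eqmod m c (toℕ k) then g (toℕ k) else 0#) ≈ g c
    on with ≋? c (toℕ k) m
    ... | inj₁ (_ , eq) rewrite eq = per (residue-≋ c m)
    ... | inj₂ (c≢k , _) = contradiction (≋-sym (residue-≋ c m)) c≢k
    off : ∀ i → i ≢ k → (if eqmod m c (toℕ i) then g (toℕ i) else 0#) ≈ 0#
    off i i≢k with ≋? c (toℕ i) m
    ... | inj₁ (c≋i , _) = contradiction (≋-toℕ (≋-trans (≋-sym c≋i) (≋-sym (residue-≋ c m)))) i≢k
    ... | inj₂ (_ , eq) rewrite eq = refl

  -- Multiplication by `a` permutes the residues. This serves both the substitution in Gaussian sums
  -- and the conjugation of Φ_r.
  sum-reindex : ∀ {m a g} .{{_ : NonZero m}} → Cancellable m a → Periodic m g →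
                ∑[ i < m ] g (a ℕ.* toℕ i) ≈ ∑[ i < m ] g (toℕ i)
  sum-reindex {m} {a} {g} can per with inverse-mod {m} {a} can
  ... | b , ab≋1 = sym (trans (∑-permute (g ∘ toℕ) (multiplication a b ab≋1))
                     (sum-cong-≋ {m} λ i → per (residue-≋ (a ℕ.* toℕ i) m)))

-- The Frobenius map in characteristic p

module Frobenius {c ℓ} (R : CommutativeRing c ℓ) where
  open CommutativeRing R hiding (zero)
  open import Algebra.Properties.CommutativeSemiring.Exp commutativeSemiring
  open import Algebra.Properties.Semiring.Mult semiring renaming (_×_ to _·_)
  open import Algebra.Properties.CommutativeSemiring.Binomial commutativeSemiring using (theorem; binomialTerm)
  open import Algebra.Properties.Ring ring using (+-inverseˡ-unique)
  open FiniteSums +-commutativeMonoid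
  open import Relation.Binary.Reasoning.Setoid setoid

  1^n≈1 : ∀ n → 1# ^ n ≈ 1#
  1^n≈1 zero    = refl
  1^n≈1 (suc n) = trans (*-identityˡ _) (1^n≈1 n)

  0^n≈0 : ∀ {n} → 0 ℕ.< n → 0# ^ n ≈ 0#
  0^n≈0 {suc n} _ = zeroˡ _

  module _ {p} (pp : Prime p) (char : p · 1# ≈ 0#) where
    multiple≈0 : ∀ {k} → p ∣ k → ∀ z → k · z ≈ 0#
    multiple≈0 (divides q ≡.refl) z = begin
      (q ℕ.* p) · z         ≈⟨ ×-assocˡ z q p ⟨
      q · (p · z)           ≈⟨ ×-congʳ q (×-congʳ p (*-identityˡ z)) ⟨
      q · (p · (1# * z))    ≈⟨ ×-congʳ q (×-assoc-* p 1# z) ⟨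
      q · ((p · 1#) * z)    ≈⟨ ×-congʳ q (trans (*-congʳ char) (zeroˡ z)) ⟩
      q · 0#                ≈⟨ trans (sym (sum-replicate q)) (sum-replicate-zero q) ⟩
      0#                    ∎

    frobenius-+ : ∀ a b → (a + b) ^ p ≈ a ^ p + b ^ p
    frobenius-+ a b = trans (theorem p a b) (go p ≡.refl)
      where
      -- A fresh variable equal to `p` can be matched as a successor, which exposes the first and
      -- the last binomial term.
      go : ∀ p′ → p′ ≡ p → sum (binomialTerm a b p′) ≈ a ^ p′ + b ^ p′
      go zero ≡.refl = contradiction (prime>1 pp) λ ()
      go (suc n) ≡.refl = begin
        t zero + sum (t ∘ suc)            ≈⟨ +-congˡ (sum-single (fromℕ n) middle) ⟩
        t zero + t (suc (fromℕ n))        ≈⟨ +-cong first last ⟩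
        b ^ suc n + a ^ suc n             ≈⟨ +-comm _ _ ⟩
        a ^ suc n + b ^ suc n             ∎
        where
        t = binomialTerm a b (suc n)
        first : t zero ≈ b ^ suc n
        first = trans (×-congˡ (nC0≡1 (suc n))) (trans (×-homo-1 _) (*-identityˡ _))
        last : t (suc (fromℕ n)) ≈ a ^ suc n
        last = top (toℕ-fromℕ n)
          where
          top : ∀ {k} → k ≡ n → (suc n C suc k) · (a ^ suc k * b ^ (n ∸ k)) ≈ a ^ suc n
          top ≡.refl = trans (×-congˡ (nCn≡1 (suc n))) (trans (×-homo-1 _)
            (trans (*-congˡ (^-congʳ b (ℕP.n∸n≡0 n))) (*-identityʳ _)))
        middle : ∀ i → i ≢ fromℕ n → t (suc i) ≈ 0#
        middle i i≢ = multiple≈0 (prime∣binomial pp ℕ.z<s (s≤s (ℕP.≤∧≢⇒< (ℕP.≤-pred (toℕ<n i))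
          (λ e → i≢ (toℕ-injective (≡.trans e (≡.sym (toℕ-fromℕ n)))))))) _

    -- Additivity gives (-a)^p + a^p = 0^p = 0; this covers p = 2 without a case distinction on
    -- parity.
    frobenius-neg : ∀ a → (- a) ^ p ≈ - (a ^ p)
    frobenius-neg a = +-inverseˡ-unique _ _ (begin
      (- a) ^ p + a ^ p   ≈⟨ frobenius-+ (- a) a ⟨
      (- a + a) ^ p       ≈⟨ ^-congˡ p (-‿inverseˡ a) ⟩
      0# ^ p              ≈⟨ 0^n≈0 (ℕP.<⇒≤ (prime>1 pp)) ⟩
      0#                  ∎)

    frobenius-sum : ∀ {n} (f : Fin n → Carrier) → sum f ^ p ≈ ∑[ i < n ] (f i ^ p)
    frobenius-sum {zero}  f = 0^n≈0 (ℕP.<⇒≤ (prime>1 pp))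
    frobenius-sum {suc n} f = trans (frobenius-+ _ _) (+-congˡ (frobenius-sum (f ∘ suc)))

-- Powers of roots of unity

module Powers {c ℓ} (R : CommutativeRing c ℓ) where
  open CommutativeRing R hiding (zero)
  open import Algebra.Properties.CommutativeSemiring.Exp commutativeSemiring renaming (_^_ to _↑_) public
  open FiniteSums +-commutativeMonoid
  open Frobenius R using (1^n≈1)
  open import Relation.Binary.Reasoning.Setoid setoid

  shift-exponent : ∀ {z m} → z ↑ m ≈ 1# → ∀ a u → z ↑ (a ℕ.+ u ℕ.* m) ≈ z ↑ a
  shift-exponent {z} {m} zᵐ≈1 a u = begin
    z ↑ (a ℕ.+ u ℕ.* m)      ≈⟨ ^-homo-* z a (u ℕ.* m) ⟩
    z ↑ a * z ↑ (u ℕ.* m)    ≈⟨ *-congˡ (^-congʳ z (ℕP.*-comm u m)) ⟩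
    z ↑ a * z ↑ (m ℕ.* u)    ≈⟨ *-congˡ (^-assocʳ z m u) ⟨
    z ↑ a * (z ↑ m) ↑ u      ≈⟨ *-congˡ (trans (^-congˡ u zᵐ≈1) (1^n≈1 u)) ⟩
    z ↑ a * 1#               ≈⟨ *-identityʳ _ ⟩
    z ↑ a                    ∎

  ↑-periodic : ∀ {z m} → z ↑ m ≈ 1# → Periodic m (z ↑_)
  ↑-periodic {z} zᵐ≈1 {a} {b} (via u v e) =
    trans (sym (shift-exponent zᵐ≈1 a u)) (trans (^-congʳ z e) (shift-exponent zᵐ≈1 b v))

  ↑-comm : ∀ z a b → (z ↑ a) ↑ b ≈ (z ↑ b) ↑ a
  ↑-comm z a b = trans (^-assocʳ z a b) (trans (^-congʳ z (ℕP.*-comm a b)) (sym (^-assocʳ z b a)))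

  root-of-unity-↑ : ∀ {z m} → z ↑ m ≈ 1# → ∀ a → (z ↑ a) ↑ m ≈ 1#
  root-of-unity-↑ {z} {m} zᵐ≈1 a = trans (↑-comm z a m) (trans (^-congˡ a zᵐ≈1) (1^n≈1 a))

-- Evaluating the group ring at roots of unity

module Evaluation {c ℓ} (R : CommutativeRing c ℓ)
  {ι : ℤ → CommutativeRing.Carrier R}
  (hom : RingMorphisms.IsRingHomomorphism ℤ.+-*-rawRing (CommutativeRing.rawRing R) ι)
  (q r : ℕ) .{{_ : NonZero q}} .{{_ : NonZero r}} (x : CommutativeRing.Carrier R) where
  open CommutativeRing R hiding (zero)
  open RingMorphisms.IsRingHomomorphism hom using ()
    renaming (0#-homo to ι-0; 1#-homo to ι-1; +-homo to ι-+; *-homo to ι-*; -‿homo to ι-neg)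
  open Powers R
  open import Algebra.Properties.Semiring.Sum semiring using (*-distribˡ-sum; *-distribʳ-sum)
  open import Algebra.Properties.Ring ring using (-‿distribˡ-*; -0#≈0#; -‿+-comm)
  open FiniteSums +-commutativeMonoid
  open import Relation.Binary.Reasoning.Setoid setoid
  open import Algebra.Properties.CommutativeSemigroup *-commutativeSemigroup using (interchange)

  -- The image of Y is an argument, unlike that of X, because `σ n` replaces `y` by `y ↑ n` and
  -- conjugates of hypothesis (2) arise by evaluating at other powers of one root.
  ev : Carrier → GR q r → Carrier
  ev y f = ∑[ i < q ] ∑[ j < r ] (ι (f i j) * (x ↑ toℕ i * y ↑ toℕ j))

  sum-if : ∀ {n} b (f : Fin n → Carrier) → ∑[ i < n ] (if b then f i else 0#) ≈ (if b then sum f else 0#)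
  sum-if true  f = refl
  sum-if {n} false f = sum-replicate-zero n

  sum-neg : ∀ {n} (f : Fin n → Carrier) → ∑[ i < n ] (- f i) ≈ - sum f
  sum-neg {zero}  f = sym -0#≈0#
  sum-neg {suc n} f = trans (+-congˡ (sum-neg (f ∘ suc))) (-‿+-comm _ _)

  ι-sumF : ∀ n (f : Fin n → ℤ) → ι (sumF n f) ≈ ∑[ i < n ] ι (f i)
  ι-sumF zero    f = ι-0
  ι-sumF (suc n) f = trans (ι-+ _ _) (+-congˡ (ι-sumF n (f ∘ suc)))

  -- Nested conditionals let `sum-δ` collapse one index at a time.
  ι-if : ∀ b b′ z w → ι (if b ∧ b′ then z else ℤ.+ 0) * w ≈ (if b then (if b′ then ι z * w else 0#) else 0#)
  ι-if true  true  z w = refl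
  ι-if true  false z w = trans (*-congʳ ι-0) (zeroˡ w)
  ι-if false b′    z w = trans (*-congʳ ι-0) (zeroˡ w)

  sum²-cong : ∀ {m n} {f g : Fin m → Fin n → Carrier} → (∀ i j → f i j ≈ g i j) →
              ∑[ i < m ] ∑[ j < n ] f i j ≈ ∑[ i < m ] ∑[ j < n ] g i j
  sum²-cong h = sum-cong-≋ λ i → sum-cong-≋ λ j → h i j

  sum²-* : ∀ {m n} a (f : Fin m → Fin n → Carrier) →
           ∑[ i < m ] ∑[ j < n ] (a * f i j) ≈ a * ∑[ i < m ] ∑[ j < n ] f i j
  sum²-* a f = sym (trans (*-distribˡ-sum a (λ i → sum (f i))) (sum-cong-≋ λ i → *-distribˡ-sum a (f i)))

  sum²-*ʳ : ∀ {m n} a (f : Fin m → Fin n → Carrier) →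
           ∑[ i < m ] ∑[ j < n ] (f i j * a) ≈ (∑[ i < m ] ∑[ j < n ] f i j) * a
  sum²-*ʳ a f = sym (trans (*-distribʳ-sum a (λ i → sum (f i))) (sum-cong-≋ λ i → *-distribʳ-sum a (f i)))

  module _ (y : Carrier) where
    ev-cong : ∀ {f g} → (∀ i j → f i j ≡ g i j) → ev y f ≈ ev y g
    ev-cong h = sum²-cong λ i j → *-congʳ (reflexive (≡.cong ι (h i j)))

    ev-⊕ : ∀ f g → ev y (f ⊕ g) ≈ ev y f + ev y g
    ev-⊕ f g = begin
      ev y (f ⊕ g)
        ≈⟨ (sum-cong-≋ λ i → trans (sum-cong-≋ λ j → trans (*-congʳ (ι-+ (f i j) (g i j))) (distribʳ _ _ _)) (∑-distrib-+ {r} _ _)) ⟩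
      _ ≈⟨ ∑-distrib-+ {q} _ _ ⟩
      ev y f + ev y g ∎

    ev-scal : ∀ z f → ev y (scal z f) ≈ ι z * ev y f
    ev-scal z f = trans (sum²-cong λ i j → trans (*-congʳ (ι-* z (f i j))) (*-assoc _ _ _)) (sum²-* {q} {r} (ι z) _)

    ev-neg : ∀ f → ev y (neg f) ≈ - ev y f
    ev-neg f = trans (sum-cong-≋ λ i → trans (sum-cong-≋ λ j → trans (*-congʳ (ι-neg (f i j))) (sym (-‿distribˡ-* _ _))) (sum-neg {r} _)) (sum-neg {q} _)

    ev-sum : ∀ n (F : Fin n → GR q r) → ev y (λ i j → sumF n λ t → F t i j) ≈ ∑[ t < n ] ev y (F t)
    ev-sum n F = begin
      ev y (λ i j → sumF n λ t → F t i j)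
        ≈⟨ (sum²-cong λ i j → trans (*-congʳ (ι-sumF n λ t → F t i j)) (*-distribʳ-sum _ λ t → ι (F t i j))) ⟩
      ∑[ i < q ] ∑[ j < r ] ∑[ t < n ] T i j t   ≈⟨ sum-cong-≋ (λ i → ∑-comm (T i)) ⟩
      ∑[ i < q ] ∑[ t < n ] ∑[ j < r ] T i j t   ≈⟨ ∑-comm (λ i t → ∑[ j < r ] T i j t) ⟩
      ∑[ t < n ] ev y (F t)                      ∎
      where
      T : Fin q → Fin r → Fin n → Carrier
      T i j t = ι (F t i j) * (x ↑ toℕ i * y ↑ toℕ j)

  module _ (x^q≈1 : x ↑ q ≈ 1#) {y : Carrier} (y^r≈1 : y ↑ r ≈ 1#) where
    -- Monomials, products and `σ` are all assembled from tables of this shape. The relations x^q =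
    -- 1 and y^r = 1 match the reduction of the exponents in the table.
    ev-monomial : ∀ a b z → ev y (λ i j → if eqmod q a (toℕ i) ∧ eqmod r b (toℕ j) then z else ℤ.+ 0)
                          ≈ ι z * (x ↑ a * y ↑ b)
    ev-monomial a b z = begin
      _ ≈⟨ (sum²-cong {q} {r} λ i j → ι-if (eqmod q a (toℕ i)) (eqmod r b (toℕ j)) z (x ↑ toℕ i * y ↑ toℕ j)) ⟩
      _ ≈⟨ (sum-cong-≋ {q} λ i → trans (sum-if {r} (eqmod q a (toℕ i)) _)
             (if-cong (eqmod q a (toℕ i)) (sum-δ {r} {λ j → ι z * (x ↑ toℕ i * y ↑ j)}
                (λ p → *-congˡ (*-congˡ (↑-periodic y^r≈1 p))) b))) ⟩
      ∑[ i < q ] (if eqmod q a (toℕ i) then ι z * (x ↑ toℕ i * y ↑ b) else 0#)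
        ≈⟨ sum-δ {q} {λ i → ι z * (x ↑ i * y ↑ b)} (λ p → *-congˡ (*-congʳ (↑-periodic x^q≈1 p))) a ⟩
      ι z * (x ↑ a * y ↑ b) ∎
      where
      if-cong : ∀ b {u v w} → u ≈ v → (if b then u else w) ≈ (if b then v else w)
      if-cong true  p = p
      if-cong false p = refl

    ev-mon : ∀ a b → ev y (mon a b) ≈ x ↑ a * y ↑ b
    ev-mon a b = trans (ev-monomial a b (ℤ.+ 1)) (trans (*-congʳ ι-1) (*-identityˡ _))

    ev-one : ev y one ≈ 1#
    ev-one = trans (ev-mon 0 0) (*-identityˡ _)

    ev-⊗ : ∀ f g → ev y (f ⊗ g) ≈ ev y f * ev y g
    ev-⊗ f g = begin
      ev y (f ⊗ g)
        ≈⟨ trans (ev-sum y q _) (sum-cong-≋ λ a → trans (ev-sum y r _) (sum-cong-≋ λ b →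
             trans (ev-sum y q _) (sum-cong-≋ λ c → trans (ev-sum y r _) (sum-cong-≋ λ d →
             ev-monomial (toℕ a ℕ.+ toℕ c) (toℕ b ℕ.+ toℕ d) (f a b ℤ.* g c d))))) ⟩
      _ ≈⟨ (sum²-cong λ a b → trans (sum²-cong λ c d → split a b c d) (sum²-* {q} {r} (T f a b) (T g))) ⟩
      _ ≈⟨ sum²-*ʳ {q} {r} (ev y g) (T f) ⟩
      ev y f * ev y g ∎
      where
      T : GR q r → Fin q → Fin r → Carrier
      T f a b = ι (f a b) * (x ↑ toℕ a * y ↑ toℕ b)
      split : ∀ a b c d → ι (f a b ℤ.* g c d) * (x ↑ (toℕ a ℕ.+ toℕ c) * y ↑ (toℕ b ℕ.+ toℕ d)) ≈ T f a b * T g c d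
      split a b c d = begin
        _ ≈⟨ *-cong (ι-* _ _) (*-cong (^-homo-* x (toℕ a) (toℕ c)) (^-homo-* y (toℕ b) (toℕ d))) ⟩
        _ ≈⟨ *-congˡ (interchange _ _ _ _) ⟩
        _ ≈⟨ interchange _ _ _ _ ⟩
        T f a b * T g c d ∎

    ev-^ : ∀ f n → ev y (f ^ᴳ n) ≈ ev y f ↑ n
    ev-^ f zero    = ev-one
    ev-^ f (suc n) = trans (ev-⊗ f (f ^ᴳ n)) (*-congˡ (ev-^ f n))

    ev-σ : ∀ n f → ev y (σ n f) ≈ ev (y ↑ n) f
    ev-σ n f = trans (ev-sum y q _) (sum-cong-≋ λ a → trans (ev-sum y r _) (sum-cong-≋ λ b →
      trans (ev-monomial (toℕ a) (n ℕ.* toℕ b) (f a b)) (*-congˡ (*-congˡ (sym (^-assocʳ y n (toℕ b)))))))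

    ev-gauss : ∀ χ → ev y (gauss q r χ) ≈
      - ∑[ m < q ] (if eqmod q (toℕ m) 0 then 0# else x ↑ toℕ m * y ↑ Character.exp χ (toℕ m))
    ev-gauss χ = trans (ev-neg y _) (-‿cong (trans (ev-sum y q _) (sum-cong-≋ {q} λ m → term m (eqmod q (toℕ m) 0))))
      where
      term : ∀ m b → ev y (λ i j → if b then ℤ.+ 0 else mon (toℕ m) (Character.exp χ (toℕ m)) i j)
                   ≈ (if b then 0# else x ↑ toℕ m * y ↑ Character.exp χ (toℕ m))
      term m true  = sum-zero {q} λ i → sum-zero {r} λ j → trans (*-congʳ ι-0) (zeroˡ _)
      term m false = ev-mon _ _

    ev-ΦX : ∑[ i < q ] (x ↑ toℕ i) ≈ 0# → ev y (ΦX q r) ≈ 0#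
    ev-ΦX Φ≈0 = begin
      ev y (ΦX q r) ≈⟨ (sum-cong-≋ {q} λ i → trans (sum-cong-≋ {r} λ j → ι-if true (eqmod r 0 (toℕ j)) (ℤ.+ 1) (x ↑ toℕ i * y ↑ toℕ j))
                         (sum-δ {r} {λ j → ι (ℤ.+ 1) * (x ↑ toℕ i * y ↑ j)} (λ p → *-congˡ (*-congˡ (↑-periodic y^r≈1 p))) 0)) ⟩
      _ ≈⟨ (sum-cong-≋ {q} λ i → trans (*-congʳ ι-1) (trans (*-identityˡ _) (*-identityʳ _))) ⟩
      _ ≈⟨ Φ≈0 ⟩
      0# ∎

-- Evaluations that factor through the cyclotomic ring modulo n

module CyclotomicEvaluation {c ℓ} (R : CommutativeRing c ℓ)
  {ι : ℤ → CommutativeRing.Carrier R}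
  (hom : RingMorphisms.IsRingHomomorphism ℤ.+-*-rawRing (CommutativeRing.rawRing R) ι)
  (q l K : ℕ) {{_ : NonZero q}} {{_ : NonZero (l ℕ.^ suc K)}} (x : CommutativeRing.Carrier R) where
  open CommutativeRing R hiding (zero)
  open Powers R
  open FiniteSums +-commutativeMonoid
  open Evaluation R hom q (l ℕ.^ suc K) x public
  open import Relation.Binary.Reasoning.Setoid setoid

  module _ (x^q≈1 : x ↑ q ≈ 1#) (Φq≈0 : ∑[ i < q ] (x ↑ toℕ i) ≈ 0#)
           {y : Carrier} (y^r≈1 : y ↑ (l ℕ.^ suc K) ≈ 1#)
           (Φr≈0 : ∑[ t < l ] (y ↑ (toℕ t ℕ.* l ℕ.^ K)) ≈ 0#) where

    ev-ΦY : ev y (ΦY q l (suc K)) ≈ 0#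
    ev-ΦY = begin
      ev y (ΦY q l (suc K))
        ≈⟨ ev-sum y l _ ⟩
      _ ≈⟨ (sum-cong-≋ {l} λ t → ev-monomial′ t) ⟩
      ∑[ t < l ] (y ↑ (toℕ t ℕ.* l ℕ.^ K)) ≈⟨ Φr≈0 ⟩
      0# ∎
      where
      ev-monomial′ : ∀ t → _ ≈ y ↑ (toℕ t ℕ.* l ℕ.^ K)
      ev-monomial′ t = trans (ev-mon x^q≈1 y^r≈1 0 (toℕ t ℕ.* l ℕ.^ K)) (*-identityˡ _)

    -- This is how hypothesis (2) enters: n, Φ_q and Φ_r all evaluate to zero, so the three
    -- multiples that witness the congruence vanish in R.
    ev-CongCyc : ∀ {n f g} → ι (ℤ.+ n) ≈ 0# → CongCyc n q l (suc K) f g → ev y f ≈ ev y g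
    ev-CongCyc {n} {f} {g} n≈0 (a , b , c , eq) = begin
      ev y f            ≈⟨ ev-cong y (λ i j → ≡.trans (add-difference (f i j) (g i j)) (≡.cong (λ z → g i j ℤ.+ z) (eq i j))) ⟩
      ev y (g ⊕ h)      ≈⟨ ev-⊕ y g h ⟩
      ev y g + ev y h   ≈⟨ +-congˡ h≈0 ⟩
      ev y g + 0#       ≈⟨ +-identityʳ _ ⟩
      ev y g            ∎
      where
      h = scal (ℤ.+ n) a ⊕ ((ΦX q (l ℕ.^ suc K) ⊗ b) ⊕ (ΦY q l (suc K) ⊗ c))
      add-difference : ∀ a b → a ≡ b ℤ.+ (a ℤ.- b)
      add-difference a b = ≡.sym (≡.trans (ℤP.+-comm b (a ℤ.- b)) (≡.trans (ℤP.+-assoc a (ℤ.- b) b)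
        (≡.trans (≡.cong (λ w → a ℤ.+ w) (ℤP.+-inverseˡ b)) (ℤP.+-identityʳ a))))
      vanish : ∀ {φ} f → ev y φ ≈ 0# → ev y (φ ⊗ f) ≈ 0#
      vanish {φ} f φ≈0 = trans (ev-⊗ x^q≈1 y^r≈1 φ f) (trans (*-congʳ φ≈0) (zeroˡ _))
      h≈0 : ev y h ≈ 0#
      h≈0 = begin
        ev y h
          ≈⟨ ev-⊕ y (scal (ℤ.+ n) a) _ ⟩
        ev y (scal (ℤ.+ n) a) + ev y ((ΦX q (l ℕ.^ suc K) ⊗ b) ⊕ (ΦY q l (suc K) ⊗ c))
          ≈⟨ +-cong (trans (ev-scal y (ℤ.+ n) a) (trans (*-congʳ n≈0) (zeroˡ _))) (ev-⊕ y (ΦX q (l ℕ.^ suc K) ⊗ b) (ΦY q l (suc K) ⊗ c)) ⟩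
        0# + (ev y (ΦX q (l ℕ.^ suc K) ⊗ b) + ev y (ΦY q l (suc K) ⊗ c))
          ≈⟨ +-congˡ (+-cong (vanish b (ev-ΦX x^q≈1 y^r≈1 Φq≈0)) (vanish c ev-ΦY)) ⟩
        0# + (0# + 0#)
          ≈⟨ trans (+-identityˡ _) (+-identityˡ _) ⟩
        0# ∎

-- The ring of shift operators on grids

-- Integer polynomials in two commuting shifts, kept as expressions: ring operations are
-- constructors, and every ring law becomes a statement about the action.
data Operator : Set where
  con     : ℤ → Operator
  X Y     : Operator
  _⊞_ _⊠_ : Operator → Operator → Operator
  ⊟_      : Operator → Operator

Grid : Set
Grid = ℕ → ℕ → ℤ

act : Operator → Grid → Grid
act (con c) s i j = c ℤ.* s i j
act X       s i j = s (suc i) j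
act Y       s i j = s i (suc j)
act (f ⊞ g) s i j = act f s i j ℤ.+ act g s i j
act (f ⊠ g) s     = act f (act g s)
act (⊟ f)   s i j = ℤ.- act f s i j

-- The commutative ring generated by the two shift operators over ℤ/p, with operators identified when
-- they agree on s₀; when the annihilator of s₀ contains Φ_q(X) and Φ_r(Y) this is a quotient of ℤ[ζ_q,ζ_r]/(p).
module ShiftRing (p : ℕ) (s₀ : Grid) where
  open import Data.Integer using (+_; _-_)

  infix 4 _~_ _≃_
  record _~_ (a b : ℤ) : Set where
    constructor difference
    field divisible : + p ℤS.∣ a - b

  ~-reflexive : ∀ {a b} → a ≡ b → a ~ b
  ~-reflexive {a} ≡.refl = difference (≡.subst (+ p ℤS.∣_) (≡.sym (ℤP.+-inverseʳ a)) (ℤS.divides (+ 0) ≡.refl))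

  ~-refl : ∀ {a} → a ~ a
  ~-refl = ~-reflexive ≡.refl

  ~-sym : ∀ {a b} → a ~ b → b ~ a
  ~-sym {a} {b} (difference d) = difference (≡.subst (+ p ℤS.∣_) (r a b) (ℤS.∣m⇒∣-m d))
    where
    r : ∀ a b → ℤ.- (a - b) ≡ b - a
    r = ℤSolver.solve-∀

  ~-trans : ∀ {a b c} → a ~ b → b ~ c → a ~ c
  ~-trans {a} {b} {c} (difference d) (difference e) = difference (≡.subst (+ p ℤS.∣_) (r a b c) (ℤS.∣m∣n⇒∣m+n d e))
    where
    r : ∀ a b c → (a - b) ℤ.+ (b - c) ≡ a - c
    r = ℤSolver.solve-∀

  +-~ : ∀ {a b c d} → a ~ b → c ~ d → a ℤ.+ c ~ b ℤ.+ d
  +-~ {a} {b} {c} {d} (difference e) (difference f) = difference (≡.subst (+ p ℤS.∣_) (r a b c d) (ℤS.∣m∣n⇒∣m+n e f))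
    where
    r : ∀ a b c d → (a - b) ℤ.+ (c - d) ≡ (a ℤ.+ c) - (b ℤ.+ d)
    r = ℤSolver.solve-∀

  neg-~ : ∀ {a b} → a ~ b → ℤ.- a ~ ℤ.- b
  neg-~ {a} {b} (difference d) = difference (≡.subst (+ p ℤS.∣_) (r a b) (ℤS.∣m⇒∣-m d))
    where
    r : ∀ a b → ℤ.- (a - b) ≡ ℤ.- a - ℤ.- b
    r = ℤSolver.solve-∀

  *-~ : ∀ c {a b} → a ~ b → c ℤ.* a ~ c ℤ.* b
  *-~ c {a} {b} (difference d) = difference (≡.subst (+ p ℤS.∣_) (r c a b) (ℤS.∣n⇒∣m*n c d))
    where
    r : ∀ c a b → c ℤ.* (a - b) ≡ c ℤ.* a - c ℤ.* b
    r = ℤSolver.solve-∀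

  _≈ᴳ_ : Grid → Grid → Set
  s ≈ᴳ t = ∀ i j → s i j ~ t i j

  _+ᴳ_ : Grid → Grid → Grid
  (s +ᴳ t) i j = s i j ℤ.+ t i j

  act-cong : ∀ f {s t} → s ≈ᴳ t → act f s ≈ᴳ act f t
  act-cong (con c) h i j = *-~ c (h i j)
  act-cong X       h i j = h (suc i) j
  act-cong Y       h i j = h i (suc j)
  act-cong (f ⊞ g) h i j = +-~ (act-cong f h i j) (act-cong g h i j)
  act-cong (f ⊠ g) h     = act-cong f (act-cong g h)
  act-cong (⊟ f)   h i j = neg-~ (act-cong f h i j)

  act-+ : ∀ f s t → act f (s +ᴳ t) ≈ᴳ (act f s +ᴳ act f t)
  act-+ (con c) s t i j = ~-reflexive (ℤP.*-distribˡ-+ c (s i j) (t i j))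
  act-+ X       s t i j = ~-refl
  act-+ Y       s t i j = ~-refl
  act-+ (f ⊞ g) s t i j = ~-trans (+-~ (act-+ f s t i j) (act-+ g s t i j))
    (~-reflexive (r (act f s i j) (act f t i j) (act g s i j) (act g t i j)))
    where
    r : ∀ a b c d → (a ℤ.+ b) ℤ.+ (c ℤ.+ d) ≡ (a ℤ.+ c) ℤ.+ (b ℤ.+ d)
    r = ℤSolver.solve-∀
  act-+ (f ⊠ g) s t i j = ~-trans (act-cong f (act-+ g s t) i j) (act-+ f (act g s) (act g t) i j)
  act-+ (⊟ f)   s t i j = ~-trans (neg-~ (act-+ f s t i j)) (~-reflexive (ℤP.neg-distrib-+ (act f s i j) (act f t i j)))

  act-con : ∀ c f s → act f (act (con c) s) ≈ᴳ act (con c) (act f s)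
  act-con c (con d) s i j = ~-reflexive (r c d (s i j))
    where
    r : ∀ c d x → d ℤ.* (c ℤ.* x) ≡ c ℤ.* (d ℤ.* x)
    r = ℤSolver.solve-∀
  act-con c X       s i j = ~-refl
  act-con c Y       s i j = ~-refl
  act-con c (f ⊞ g) s i j = ~-trans (+-~ (act-con c f s i j) (act-con c g s i j))
    (~-reflexive (≡.sym (ℤP.*-distribˡ-+ c (act f s i j) (act g s i j))))
  act-con c (f ⊠ g) s i j = ~-trans (act-cong f (act-con c g s) i j) (act-con c f (act g s) i j)
  act-con c (⊟ f)   s i j = ~-trans (neg-~ (act-con c f s i j)) (~-reflexive (ℤP.neg-distribʳ-* c (act f s i j)))

  act-X : ∀ f s → act f (act X s) ≈ᴳ act X (act f s)
  act-X (con c) s i j = ~-refl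
  act-X X       s i j = ~-refl
  act-X Y       s i j = ~-refl
  act-X (f ⊞ g) s i j = +-~ (act-X f s i j) (act-X g s i j)
  act-X (f ⊠ g) s i j = ~-trans (act-cong f (act-X g s) i j) (act-X f (act g s) i j)
  act-X (⊟ f)   s i j = neg-~ (act-X f s i j)

  act-Y : ∀ f s → act f (act Y s) ≈ᴳ act Y (act f s)
  act-Y (con c) s i j = ~-refl
  act-Y X       s i j = ~-refl
  act-Y Y       s i j = ~-refl
  act-Y (f ⊞ g) s i j = +-~ (act-Y f s i j) (act-Y g s i j)
  act-Y (f ⊠ g) s i j = ~-trans (act-cong f (act-Y g s) i j) (act-Y f (act g s) i j)
  act-Y (⊟ f)   s i j = neg-~ (act-Y f s i j)

  -- Negation is multiplication by the constant -1, and constants commute with every operator.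
  act-neg : ∀ f s → act f (λ i j → ℤ.- s i j) ≈ᴳ (λ i j → ℤ.- act f s i j)
  act-neg f s i j = ~-trans (act-cong f (λ i j → ~-reflexive (≡.sym (ℤP.-1*i≡-i (s i j)))) i j)
    (~-trans (act-con (ℤ.-1ℤ) f s i j) (~-reflexive (ℤP.-1*i≡-i (act f s i j))))

  -- Induction on `f`: the generators commute with every operator by the lemmas above, and a sum
  -- passes through `g` because `g` acts additively.
  act-comm : ∀ f g s → act f (act g s) ≈ᴳ act g (act f s)
  act-comm (con c) g s i j = ~-sym (act-con c g s i j)
  act-comm X       g s i j = ~-sym (act-X g s i j)
  act-comm Y       g s i j = ~-sym (act-Y g s i j)
  act-comm (f ⊞ h) g s i j = ~-trans (+-~ (act-comm f g s i j) (act-comm h g s i j)) (~-sym (act-+ g (act f s) (act h s) i j))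
  act-comm (f ⊠ h) g s i j = ~-trans (act-cong f (act-comm h g s) i j) (act-comm f g (act h s) i j)
  act-comm (⊟ f)   g s i j = ~-trans (neg-~ (act-comm f g s i j)) (~-sym (act-neg g (act f s) i j))

  record _≃_ (f g : Operator) : Set where
    constructor agree
    field at : act f s₀ ≈ᴳ act g s₀
  open _≃_ public

  shiftRing : CommutativeRing _ _
  shiftRing = record
    { Carrier = Operator
    ; _≈_ = _≃_
    ; _+_ = _⊞_
    ; _*_ = _⊠_
    ; -_  = ⊟_
    ; 0#  = con (+ 0)
    ; 1#  = con (+ 1)
    ; isCommutativeRing = record
      { isRing = record
        { +-isAbelianGroup = record
          { isGroup = record
            { isMonoid = record
              { isSemigroup = record
                { isMagma = record
                  { isEquivalence = record
                    { refl  = agree λ i j → ~-refl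
                    ; sym   = λ p → agree λ i j → ~-sym (at p i j)
                    ; trans = λ p q → agree λ i j → ~-trans (at p i j) (at q i j)
                    }
                  ; ∙-cong = λ p q → agree λ i j → +-~ (at p i j) (at q i j)
                  }
                ; assoc = λ f g h → agree λ i j → ~-reflexive (ℤP.+-assoc (act f s₀ i j) _ _)
                }
              ; identity = (λ f → agree λ i j → ~-reflexive (r₁ (s₀ i j) (act f s₀ i j)))
                         , (λ f → agree λ i j → ~-reflexive (r₂ (s₀ i j) (act f s₀ i j)))
              }
            ; inverse = (λ f → agree λ i j → ~-reflexive (r₃ (s₀ i j) (act f s₀ i j)))
                      , (λ f → agree λ i j → ~-reflexive (r₄ (s₀ i j) (act f s₀ i j)))
            ; ⁻¹-cong = λ p → agree λ i j → neg-~ (at p i j)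
            }
          ; comm = λ f g → agree λ i j → ~-reflexive (ℤP.+-comm (act f s₀ i j) _)
          }
        -- Equality is tested on `s₀` alone, so `f` may be exchanged for `f′` only where it acts
        -- directly on `s₀`; commuting `g′` to the outside puts it there.
        ; *-cong = λ {f} {f′} {g} {g′} p q → agree λ i j → ~-trans (act-cong f (at q) i j)
                     (~-trans (act-comm f g′ s₀ i j) (~-trans (act-cong g′ (at p) i j) (act-comm g′ f′ s₀ i j)))
        ; *-assoc = λ f g h → agree λ i j → ~-refl
        ; *-identity = (λ f → agree λ i j → ~-reflexive (ℤP.*-identityˡ (act f s₀ i j)))
                     , (λ f → agree λ i j → ~-trans (act-con (+ 1) f s₀ i j) (~-reflexive (ℤP.*-identityˡ (act f s₀ i j))))
        ; distrib = (λ f g h → agree λ i j → act-+ f (act g s₀) (act h s₀) i j)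
                  , (λ f g h → agree λ i j → ~-refl)
        }
      ; *-comm = λ f g → agree λ i j → act-comm f g s₀ i j
      }
    }
    where
    r₁ : ∀ s f → + 0 ℤ.* s ℤ.+ f ≡ f
    r₁ = ℤSolver.solve-∀
    r₂ : ∀ s f → f ℤ.+ + 0 ℤ.* s ≡ f
    r₂ = ℤSolver.solve-∀
    r₃ : ∀ s f → ℤ.- f ℤ.+ f ≡ + 0 ℤ.* s
    r₃ = ℤSolver.solve-∀
    r₄ : ∀ s f → f ℤ.+ ℤ.- f ≡ + 0 ℤ.* s
    r₄ = ℤSolver.solve-∀

  open CommutativeRing shiftRing using (rawRing; semiring; +-congˡ) renaming (refl to ≃-refl; trans to ≃-trans; sym to ≃-sym)
  open import Algebra.Properties.Semiring.Exp semiring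
  open import Algebra.Properties.Semiring.Mult semiring renaming (_×_ to _·_) using ()
  open import Algebra.Properties.Semiring.Sum semiring using (sum)
  module ℤΣ = FiniteSums ℤP.+-0-commutativeMonoid

  con-+ : ∀ a b → con (a ℤ.+ b) ≃ con a ⊞ con b
  con-+ a b = agree λ i j → ~-reflexive (ℤP.*-distribʳ-+ (s₀ i j) a b)

  con-* : ∀ a b → con (a ℤ.* b) ≃ con a ⊠ con b
  con-* a b = agree λ i j → ~-reflexive (ℤP.*-assoc a b (s₀ i j))

  con-neg : ∀ a → con (ℤ.- a) ≃ ⊟ con a
  con-neg a = agree λ i j → ~-reflexive (≡.sym (ℤP.neg-distribˡ-* a (s₀ i j)))

  con-homomorphism : RingMorphisms.IsRingHomomorphism ℤ.+-*-rawRing rawRing con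
  con-homomorphism = record
    { isSemiringHomomorphism = record
      { isNearSemiringHomomorphism = record
        { +-isMonoidHomomorphism = record
          { isMagmaHomomorphism = record
            { isRelHomomorphism = record { cong = λ { ≡.refl → ≃-refl } }
            ; homo = con-+
            }
          ; ε-homo = ≃-refl
          }
        ; *-homo = con-*
        }
      ; 1#-homo = ≃-refl
      }
    ; -‿homo = con-neg
    }

  con-multiple : ∀ k → con (+ (k ℕ.* p)) ≃ con (+ 0)
  con-multiple k = agree λ i j → difference (≡.subst (+ p ℤS.∣_) (eq (s₀ i j)) (ℤS.∣m⇒∣m*n (s₀ i j) (ℤS.∣n⇒∣m*n (+ k) (ℤS.∣-refl {+ p}))))
    where
    r : ∀ a s → a ℤ.* s ≡ a ℤ.* s - + 0 ℤ.* s
    r = ℤSolver.solve-∀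
    eq : ∀ s → + k ℤ.* + p ℤ.* s ≡ + (k ℕ.* p) ℤ.* s - + 0 ℤ.* s
    eq s = ≡.trans (≡.cong (ℤ._* s) (≡.sym (ℤP.pos-* k p))) (r (+ (k ℕ.* p)) s)

  ·-con : ∀ n → n · con (+ 1) ≃ con (+ n)
  ·-con zero    = agree λ i j → ~-refl
  ·-con (suc n) = ≃-trans (+-congˡ (·-con n)) (≃-sym (con-+ (+ 1) (+ n)))

  act-X^ : ∀ n s i j → act (X ^ n) s i j ≡ (s (i ℕ.+ n) j)
  act-X^ zero    s i j = ≡.trans (ℤP.*-identityˡ _) (≡.cong (λ k → s k j) (≡.sym (ℕP.+-identityʳ i)))
  act-X^ (suc n) s i j = ≡.trans (act-X^ n s (suc i) j) (≡.cong (λ k → s k j) (≡.sym (ℕP.+-suc i n)))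

  act-Y^ : ∀ n s i j → act (Y ^ n) s i j ≡ (s i (j ℕ.+ n))
  act-Y^ zero    s i j = ≡.trans (ℤP.*-identityˡ _) (≡.cong (s i) (≡.sym (ℕP.+-identityʳ j)))
  act-Y^ (suc n) s i j = ≡.trans (act-Y^ n s i (suc j)) (≡.cong (s i) (≡.sym (ℕP.+-suc j n)))

  act-sum : ∀ {n} (f : Fin n → Operator) i j → act (sum f) s₀ i j ≡ ℤΣ.sum (λ t → act (f t) s₀ i j)
  act-sum {zero}  f i j = ≡.refl
  act-sum {suc n} f i j = ≡.cong (λ w → act (f zero) s₀ i j ℤ.+ w) (act-sum (f ∘ suc) i j)

  sum-telescopes : ∀ n (F : ℕ → ℤ) → ℤΣ.sum {n} (λ t → F (toℕ t) - F (suc (toℕ t))) ≡ F 0 - F n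
  sum-telescopes zero    F = ≡.sym (ℤP.+-inverseʳ (F 0))
  sum-telescopes (suc n) F = ≡.trans (≡.cong (λ w → (F 0 - F 1) ℤ.+ w) (sum-telescopes n (F ∘ suc))) (r (F 0) (F 1) (F (suc n)))
    where
    r : ∀ a b c → (a - b) ℤ.+ (b - c) ≡ a - c
    r = ℤSolver.solve-∀

-- A grid annihilated by both cyclotomic polynomials

indicator : ℕ → ℕ → ℤ
indicator m i = if eqmod m i 0 then ℤ.+ 1 else ℤ.+ 0

indicator-periodic : ∀ {m a b} → a ≋ b ⟨ m ⟩ → indicator m a ≡ indicator m b
indicator-periodic {m} {a} {b} a≋b with ≋? a 0 m | ≋? b 0 m
... | inj₁ (_ , e) | inj₁ (_ , f) rewrite e | f = ≡.refl
... | inj₂ (_ , e) | inj₂ (_ , f) rewrite e | f = ≡.refl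
... | inj₁ (z , _) | inj₂ (n , _) = contradiction (≋-trans (≋-sym a≋b) z) n
... | inj₂ (n , _) | inj₁ (z , _) = contradiction (≋-trans a≋b z) n

indicator-yes : ∀ {m a} → a ≋ 0 ⟨ m ⟩ → indicator m a ≡ ℤ.+ 1
indicator-yes {m} {a} z with ≋? a 0 m
... | inj₁ (_ , e) rewrite e = ≡.refl
... | inj₂ (n , _) = contradiction z n

indicator-no : ∀ {m a} → ¬ a ≋ 0 ⟨ m ⟩ → indicator m a ≡ ℤ.+ 0
indicator-no {m} {a} n with ≋? a 0 m
... | inj₁ (z , _) = contradiction z n
... | inj₂ (_ , e) rewrite e = ≡.refl

small≋0 : ∀ {m a} → a ℕ.< m → a ≋ 0 ⟨ m ⟩ → a ≡ 0
small≋0 a<m z = residue-unique a<m (ℕP.≤-trans (s≤s z≤n) a<m) z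

-- (1 − X^w) applied to the indicator of mℤ
jump : ℕ → ℕ → ℕ → ℤ
jump m w i = indicator m i ℤ.- indicator m (i ℕ.+ w)

-- s₀ = (1 − X)(1 − Y^(r/l)) applied to the indicator of qℤ × rℤ, so that Φ_q(X) and Φ_r(Y) annihilate it by telescoping.
module Model (p q l K : ℕ) (pp : Prime p) (pq : Prime q) (pl : Prime l) where
  open import Data.Integer using (+_; _-_)

  r = l ℕ.^ suc K
  r/l = l ℕ.^ K

  open ShiftRing p (λ i j → jump q 1 i ℤ.* jump r r/l j) public
  s₀ : Grid
  s₀ i j = jump q 1 i ℤ.* jump r r/l j
  open CommutativeRing shiftRing using (semiring; 0#; 1#; _≈_)
  open import Algebra.Properties.Semiring.Exp semiring
  open import Algebra.Properties.Semiring.Mult semiring renaming (_×_ to _·_) using ()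
  open import Algebra.Properties.Semiring.Sum semiring using (sum; sum-syntax)

  jump-periodic : ∀ m w {a b} → a ≋ b ⟨ m ⟩ → jump m w a ≡ jump m w b
  jump-periodic m w a≋b = ≡.cong₂ _-_ (indicator-periodic a≋b) (indicator-periodic (+-≋ a≋b ≋-refl))

  i+m≋i : ∀ {m} i → i ℕ.+ m ≋ i ⟨ m ⟩
  i+m≋i {m} i = via 0 1 (≡.trans (ℕP.+-identityʳ _) (≡.cong (λ w → i ℕ.+ w) (≡.sym (ℕP.+-identityʳ m))))

  X^q≈1 : X ^ q ≈ 1#
  X^q≈1 = agree λ i j → ~-reflexive (≡.trans (act-X^ q s₀ i j)
    (≡.trans (≡.cong (ℤ._* jump r r/l j) (jump-periodic q 1 (i+m≋i i))) (≡.sym (ℤP.*-identityˡ (s₀ i j)))))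

  Y^r≈1 : Y ^ r ≈ 1#
  Y^r≈1 = agree λ i j → ~-reflexive (≡.trans (act-Y^ r s₀ i j)
    (≡.trans (≡.cong (jump q 1 i ℤ.*_) (jump-periodic r r/l (i+m≋i j))) (≡.sym (ℤP.*-identityˡ (s₀ i j)))))

  p≈0 : p · 1# ≈ 0#
  p≈0 = ≃-trans (·-con p) (≡.subst (λ k → con (+ k) ≈ 0#) (ℕP.*-identityˡ p) (con-multiple 1))
    where open CommutativeRing shiftRing using () renaming (trans to ≃-trans)

  -- As n·w = m, the telescoped sum spans one full period and its two ends agree. The case w = 1
  -- serves Φ_q, the case w = r/l serves Φ_r.
  jumps-cancel : ∀ {m} w i n → n ℕ.* w ≡ m → ℤΣ.sum {n} (λ t → jump m w (i ℕ.+ toℕ t ℕ.* w)) ≡ + 0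
  jumps-cancel {m} w i n ≡.refl = ≡.trans
    (ℤΣ.sum-cong-≗ {n} λ t → ≡.cong (λ k → F (toℕ t) - indicator m k)
      (≡.trans (ℕP.+-assoc i (toℕ t ℕ.* w) w) (≡.cong (λ k → i ℕ.+ k) (ℕP.+-comm (toℕ t ℕ.* w) w))))
    (≡.trans (sum-telescopes n F)
      (≡.trans (≡.cong (F 0 -_) (indicator-periodic (≋-trans (i+m≋i i) (≋-reflexive (≡.sym (ℕP.+-identityʳ i))))))
        (ℤP.+-inverseʳ (F 0))))
    where
    F : ℕ → ℤ
    F t = indicator m (i ℕ.+ t ℕ.* w)

  ΦX≈0 : ∑[ t < q ] (X ^ toℕ t) ≈ 0#
  ΦX≈0 = agree λ i j → ~-reflexive (≡.trans (act-sum (λ (t : Fin q) → X ^ toℕ t) i j) (≡.trans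
    (ℤΣ.sum-cong-≗ {q} λ t → ≡.trans (act-X^ (toℕ t) s₀ i j)
      (≡.cong (λ k → jump q 1 (i ℕ.+ k) ℤ.* jump r r/l j) (≡.sym (ℕP.*-identityʳ (toℕ t)))))
    (≡.trans (≡.sym (*-distribʳ-sum (jump r r/l j) (λ (t : Fin q) → jump q 1 (i ℕ.+ toℕ t ℕ.* 1))))
    (≡.trans (≡.cong (ℤ._* jump r r/l j) (jumps-cancel 1 i q (ℕP.*-identityʳ q)))
      (≡.trans (ℤP.*-zeroˡ (jump r r/l j)) (≡.sym (ℤP.*-zeroˡ (s₀ i j))))))))
    where open import Algebra.Properties.Semiring.Sum ℤP.+-*-semiring using (*-distribʳ-sum)

  ΦY≈0 : ∑[ t < l ] (Y ^ (toℕ t ℕ.* r/l)) ≈ 0#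
  ΦY≈0 = agree λ i j → ~-reflexive (≡.trans (act-sum (λ (t : Fin l) → Y ^ (toℕ t ℕ.* r/l)) i j) (≡.trans
    (ℤΣ.sum-cong-≗ {l} λ t → act-Y^ (toℕ t ℕ.* r/l) s₀ i j)
    (≡.trans (≡.sym (*-distribˡ-sum (jump q 1 i) (λ (t : Fin l) → jump r r/l (j ℕ.+ toℕ t ℕ.* r/l))))
    (≡.trans (≡.cong (jump q 1 i ℤ.*_) (jumps-cancel r/l j l ≡.refl))
      (≡.trans (ℤP.*-zeroʳ (jump q 1 i)) (≡.sym (ℤP.*-zeroˡ (s₀ i j))))))))
    where open import Algebra.Properties.Semiring.Sum ℤP.+-*-semiring using (*-distribˡ-sum)

  -- At the point (q − 1 , −e 1) only the term with m = 1 is nonzero.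
  gauss-sum≉0 : ∀ (e : ℕ → ℕ) → ¬ (∑[ m < q ] (if eqmod q (toℕ m) 0 then 0# else (X ^ toℕ m) ⊠ (Y ^ e (toℕ m))) ≈ 0#)
  gauss-sum≉0 e sum≈0 = p∤1 (~-trans (~-reflexive (≡.sym value)) (~-trans (at sum≈0 i₀ j₀) (~-reflexive (ℤP.*-zeroˡ (s₀ i₀ j₀)))))
    where
    instance _ = ℕP.m^n≢0 l (suc K) {{prime⇒nonZero pl}}
    i₀ = q ℕ.∸ 1
    -- A natural number congruent to -e 1 modulo r.
    j₀ = e 1 ℕ.* ℕ.pred r
    p∤1 : ¬ (+ 1 ~ + 0)
    p∤1 (difference d) = ℕP.<⇒≱ (prime>1 pp) (∣⇒≤ (ℤS.∣⇒∣ᵤ d))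
    term : Fin q → Operator
    term m = if eqmod q (toℕ m) 0 then 0# else (X ^ toℕ m) ⊠ (Y ^ e (toℕ m))
    1F : Fin q
    1F = fromℕ< (prime>1 pq)
    toℕ-1F : toℕ 1F ≡ 1
    toℕ-1F = toℕ-fromℕ< (prime>1 pq)
    act-monomial : ∀ a b i j → act ((X ^ a) ⊠ (Y ^ b)) s₀ i j ≡ s₀ (i ℕ.+ a) (j ℕ.+ b)
    act-monomial a b i j = ≡.trans (act-X^ a (act (Y ^ b) s₀) i j) (act-Y^ b s₀ (i ℕ.+ a) j)
    i₀+1 : ∀ {a} → i₀ ℕ.+ suc a ≡ q ℕ.+ a
    i₀+1 {a} = ≡.trans (≡.sym (ℕP.+-assoc i₀ 1 a)) (≡.cong (ℕ._+ a) (ℕP.m∸n+n≡m (ℕP.<⇒≤ (prime>1 pq))))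
    q+a≋a : ∀ a → q ℕ.+ a ≋ a ⟨ q ⟩
    q+a≋a a = ≋-trans (≋-reflexive (ℕP.+-comm q a)) (i+m≋i a)
    r/l<r : r/l ℕ.< r
    r/l<r = ℕP.^-monoʳ-< l (prime>1 pl) (ℕP.n<1+n K)
    jump-one : ∀ {m w a} → 0 ℕ.< w → w ℕ.< m → a ≋ 0 ⟨ m ⟩ → jump m w a ≡ + 1
    jump-one {m} {w} 0<w w<m z = ≡.cong₂ _-_ (indicator-yes z) (indicator-no λ z′ →
      ℕP.<⇒≢ 0<w (≡.sym (small≋0 w<m (≋-trans (+-≋ (≋-sym z) (≋-refl {w})) z′))))
    -- The jump is nonzero only at 0 and -1 modulo q. Relative to `i₀` these are m = 1 and m = 0,
    -- and the Gaussian sum has no term at m = 0.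
    jump-zero : ∀ a → suc a ℕ.< q → a ≢ 0 → jump q 1 (i₀ ℕ.+ suc a) ≡ + 0
    jump-zero a a<q a≢0 = ≡.cong₂ _-_
      (indicator-no λ z → a≢0 (small≋0 (ℕP.<-trans (ℕP.n<1+n a) a<q) (≋-trans (≋-sym (q+a≋a a)) (≋-trans (≋-reflexive (≡.sym (i₀+1 {a}))) z))))
      (indicator-no λ z → ℕP.1+n≢0 (small≋0 a<q (≋-trans (≋-sym (q+a≋a (suc a)))
         (≋-trans (≋-reflexive (≡.trans (ℕP.+-suc q a) (≡.trans (ℕP.+-comm 1 _) (≡.cong (ℕ._+ 1) (≡.sym (i₀+1 {a})))))) z))))
    other : ∀ m → m ≢ 1F → act (term m) s₀ i₀ j₀ ≡ + 0
    other m m≢1 with ≋? (toℕ m) 0 q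
    ... | inj₁ (_ , eq) rewrite eq = ℤP.*-zeroˡ (s₀ i₀ j₀)
    ... | inj₂ (m≢0 , eq) rewrite eq = ≡.trans (act-monomial (toℕ m) (e (toℕ m)) i₀ j₀)
        (≡.trans (≡.cong (ℤ._* jump r r/l (j₀ ℕ.+ e (toℕ m))) (nonzero (toℕ m) (toℕ<n m) (λ z → m≢0 (≋-reflexive z)) λ z → m≢1 (toℕ-injective (≡.trans z (≡.sym toℕ-1F)))))
          (ℤP.*-zeroˡ (jump r r/l (j₀ ℕ.+ e (toℕ m)))))
      where
      nonzero : ∀ a → a ℕ.< q → a ≢ 0 → a ≢ 1 → jump q 1 (i₀ ℕ.+ a) ≡ + 0
      nonzero zero    _   a≢0 _   = contradiction ≡.refl a≢0
      nonzero (suc a) a<q _   a≢1 = jump-zero a a<q (a≢1 ∘ ≡.cong suc)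
    main : act (term 1F) s₀ i₀ j₀ ≡ + 1
    main with ≋? (toℕ 1F) 0 q
    ... | inj₁ (z , _) = contradiction (≡.trans (≡.sym toℕ-1F) (small≋0 (toℕ<n 1F) z)) λ ()
    ... | inj₂ (_ , eq) rewrite eq | toℕ-1F = ≡.trans (act-monomial 1 (e 1) i₀ j₀)
      (≡.cong₂ ℤ._*_
        (jump-one ℕ.z<s (prime>1 pq) (≋-trans (≋-reflexive (i₀+1 {0})) (q+a≋a 0)))
        (jump-one (ℕP.m^n>0 l {{prime⇒nonZero pl}} K) r/l<r (∣⇒≋0 (divides (e 1)
          (≡.trans (ℕP.+-comm j₀ (e 1)) (≡.trans (≡.sym (ℕP.*-suc (e 1) (ℕ.pred r))) (≡.cong (e 1 ℕ.*_) (ℕP.suc-pred r))))))))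
    value : act (sum term) s₀ i₀ j₀ ≡ + 1
    value = ≡.trans (act-sum term i₀ j₀) (≡.trans (ℤΣ.sum-single 1F other) main)

-- Gaussian sums in characteristic p

∤-^ : ∀ {l a} → Prime l → ¬ l ∣ a → ∀ i → ¬ l ∣ a ℕ.^ i
∤-^ pl l∤a zero    d = contradiction (∣1⇒≡1 d) (ℕP.<⇒≢ (prime>1 pl) ∘ ≡.sym)
∤-^ {a = a} pl l∤a (suc i) d = [ l∤a , ∤-^ pl l∤a i ]′ (euclidsLemma a (a ℕ.^ i) pl d)

∤-∸1 : ∀ {l} → Prime l → ¬ l ∣ l ∸ 1
∤-∸1 {l} pl d with l ∸ 1 in eq
... | zero  = ℕP.<⇒≱ (prime>1 pl) (ℕP.m∸n≡0⇒m≤n eq)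
... | suc k = ℕP.<⇒≱ (ℕP.≤-reflexive (≡.trans (≡.cong suc (≡.sym eq)) (ℕP.m+[n∸m]≡n (ℕP.<⇒≤ (prime>1 pl))))) (∣⇒≤ d)

module GaussSums {c ℓ} (R : CommutativeRing c ℓ) where
  open CommutativeRing R hiding (zero)
  open Powers R
  open FiniteSums +-commutativeMonoid
  open Mult semiring renaming (_×_ to _·_) using (×-homo-+; ×-assocˡ; ×-congʳ; ×-congˡ)
  open Frobenius R
  open import Algebra.Properties.Semiring.Sum semiring using (*-distribˡ-sum; *-distribʳ-sum)
  open import Algebra.Properties.Ring ring using (-‿distribʳ-*)
  open import Relation.Binary.Reasoning.Setoid setoid

  module AtRoots
    {p q l K : ℕ} (pp : Prime p) (pq : Prime q) (pl : Prime l) (q∤p : ¬ q ∣ p) (l∤p : ¬ l ∣ p)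
    (p≈0 : p · 1# ≈ 0#) (x y : Carrier) (x^q≈1 : x ↑ q ≈ 1#) (y^r≈1 : y ↑ (l ℕ.^ suc K) ≈ 1#)
    (Φr≈0 : ∑[ t < l ] (y ↑ (toℕ t ℕ.* l ℕ.^ K)) ≈ 0#)
    (e : ℕ → ℕ) (e-cong : ∀ {a b} → a ≋ b ⟨ q ⟩ → e a ≋ e b ⟨ l ℕ.^ suc K ⟩)
    (e-* : ∀ a b → ¬ q ∣ a → ¬ q ∣ b → e (a ℕ.* b) ≋ e a ℕ.+ e b ⟨ l ℕ.^ suc K ⟩)
    where
    r = l ℕ.^ suc K
    instance
      _ = prime⇒nonZero pq
      _ = prime⇒nonZero pl
      _ = prime⇒nonZero pp
      _ = ℕP.m^n≢0 l (suc K)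

    term : ℕ → ℕ → Carrier
    term a m = if eqmod q m 0 then 0# else x ↑ m * y ↑ (a ℕ.* e m)

    τ : ℕ → Carrier
    τ a = - ∑[ m < q ] term a (toℕ m)

    y-cong : ∀ {a b} → a ≋ b ⟨ r ⟩ → y ↑ a ≈ y ↑ b
    y-cong = ↑-periodic y^r≈1

    τ-cong : ∀ {a b} → a ≋ b ⟨ r ⟩ → τ a ≈ τ b
    τ-cong {a} {b} a≋b = -‿cong (sum-cong-≋ {q} λ m → term-cong (toℕ m))
      where
      term-cong : ∀ m → term a m ≈ term b m
      term-cong m with eqmod q m 0
      ... | true  = refl
      ... | false = *-congˡ (y-cong (*-≋ˡ a≋b))

    term-periodic : ∀ a → Periodic q (term a)
    term-periodic a {m} {m′} m≋m′ with ≋? m 0 q | ≋? m′ 0 q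
    ... | inj₁ (_ , eq) | inj₁ (_ , eq′) rewrite eq | eq′ = refl
    ... | inj₂ (_ , eq) | inj₂ (_ , eq′) rewrite eq | eq′ = *-cong (↑-periodic x^q≈1 m≋m′) (y-cong (*-≋ʳ a (e-cong m≋m′)))
    ... | inj₁ (z , _)  | inj₂ (n , _) = contradiction (≋-trans (≋-sym m≋m′) z) n
    ... | inj₂ (n , _)  | inj₁ (z , _) = contradiction (≋-trans m≋m′ z) n

    -- The p-th power turns x^m χ(m)^a into x^(pm) χ(m)^(pa), and the prefactor χ(p)^(pa) completes
    -- χ(m) to χ(pm).
    term-frobenius : ∀ a m → y ↑ (p ℕ.* a ℕ.* e p) * term a m ↑ p ≈ term (p ℕ.* a) (p ℕ.* m)
    term-frobenius a m with ≋? m 0 q | ≋? (p ℕ.* m) 0 q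
    ... | inj₁ (_ , eq) | inj₁ (_ , eq′) rewrite eq | eq′ = trans (*-congˡ (0^n≈0 (ℕP.<⇒≤ (prime>1 pp)))) (zeroʳ _)
    ... | inj₁ (z , _)  | inj₂ (n , _)  = contradiction (≋-trans (*-≋ʳ p z) (≋-reflexive (ℕP.*-zeroʳ p))) n
    ... | inj₂ (n , _)  | inj₁ (z , _)  = contradiction (∣⇒≋0 (prime-cancellable pq q∤p m (≋0⇒∣ z))) n
    ... | inj₂ (n , eq) | inj₂ (_ , eq′) rewrite eq | eq′ = begin
      y ↑ (p ℕ.* a ℕ.* e p) * (x ↑ m * y ↑ (a ℕ.* e m)) ↑ p
        ≈⟨ *-congˡ (trans (^-distrib-* _ _ p) (*-cong (trans (^-assocʳ x m p) (^-congʳ x (ℕP.*-comm m p))) (^-assocʳ y (a ℕ.* e m) p))) ⟩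
      y ↑ (p ℕ.* a ℕ.* e p) * (x ↑ (p ℕ.* m) * y ↑ (a ℕ.* e m ℕ.* p))
        ≈⟨ trans (sym (*-assoc _ _ _)) (trans (*-congʳ (*-comm _ _)) (*-assoc _ _ _)) ⟩
      x ↑ (p ℕ.* m) * (y ↑ (p ℕ.* a ℕ.* e p) * y ↑ (a ℕ.* e m ℕ.* p))
        ≈⟨ *-congˡ (^-homo-* y (p ℕ.* a ℕ.* e p) _) ⟨
      x ↑ (p ℕ.* m) * y ↑ (p ℕ.* a ℕ.* e p ℕ.+ a ℕ.* e m ℕ.* p)
        ≈⟨ *-congˡ (y-cong (≋-trans (≋-reflexive (arith p a (e p) (e m))) (*-≋ʳ (p ℕ.* a) (≋-sym (e-* p m q∤p (n ∘ ∣⇒≋0)))))) ⟩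
      x ↑ (p ℕ.* m) * y ↑ (p ℕ.* a ℕ.* e (p ℕ.* m)) ∎
      where
      arith : ∀ p a u v → p ℕ.* a ℕ.* u ℕ.+ a ℕ.* v ℕ.* p ≡ p ℕ.* a ℕ.* (u ℕ.+ v)
      arith = ℕSolver.solve-∀

    τ-frobenius : ∀ a → τ (p ℕ.* a) ≈ y ↑ (p ℕ.* a ℕ.* e p) * τ a ↑ p
    τ-frobenius a = sym (begin
      w * τ a ↑ p                                   ≈⟨ *-congˡ (frobenius-neg pp p≈0 _) ⟩
      w * (- (∑[ m < q ] term a (toℕ m)) ↑ p)       ≈⟨ -‿distribʳ-* _ _ ⟨
      - (w * (∑[ m < q ] term a (toℕ m)) ↑ p)       ≈⟨ -‿cong (*-congˡ (frobenius-sum pp p≈0 {q} (term a ∘ toℕ))) ⟩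
      - (w * ∑[ m < q ] (term a (toℕ m) ↑ p))       ≈⟨ -‿cong (*-distribˡ-sum w (λ (m : Fin q) → term a (toℕ m) ↑ p)) ⟩
      - (∑[ m < q ] (w * term a (toℕ m) ↑ p))       ≈⟨ -‿cong (sum-cong-≋ {q} λ m → term-frobenius a (toℕ m)) ⟩
      - (∑[ m < q ] term (p ℕ.* a) (p ℕ.* toℕ m))   ≈⟨ -‿cong (sum-reindex {q} {p} {term (p ℕ.* a)} (prime-cancellable pq q∤p) (term-periodic (p ℕ.* a))) ⟩
      τ (p ℕ.* a)                                   ∎)
      where w = y ↑ (p ℕ.* a ℕ.* e p)

    -- The common shape of the Frobenius relation (c = p, d = e p) and of hypothesis (2) (c = n, d =
    -- j'). The restriction on `a` is there for the second, whose conjugate at Y^a requires Φ_r(Y^a)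
    -- = 0.
    Equivariant : ℕ → ℕ → Set ℓ
    Equivariant c d = ∀ a → ¬ l ∣ a → τ (c ℕ.* a) ≈ y ↑ (c ℕ.* a ℕ.* d) * τ a ↑ c

    -- Each of the i steps contributes the same exponent c^i·d in the end, because the root produced
    -- early is raised to the power c by every later step.
    equivariant-iterate : ∀ {c d} → ¬ l ∣ c → Equivariant c d → ∀ i →
      τ (c ℕ.^ i) ≈ y ↑ (i ℕ.* c ℕ.^ i ℕ.* d) * τ 1 ↑ (c ℕ.^ i)
    equivariant-iterate l∤c equi zero = sym (trans (*-identityˡ _) (*-identityʳ _))
    equivariant-iterate {c} {d} l∤c equi (suc i) = begin
      τ (c ℕ.* cⁱ)                                                            ≈⟨ equi cⁱ (∤-^ pl l∤c i) ⟩
      y ↑ (c ℕ.* cⁱ ℕ.* d) * τ cⁱ ↑ c                                         ≈⟨ *-congˡ (^-congˡ c (equivariant-iterate l∤c equi i)) ⟩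
      y ↑ (c ℕ.* cⁱ ℕ.* d) * (y ↑ (i ℕ.* cⁱ ℕ.* d) * τ 1 ↑ cⁱ) ↑ c
        ≈⟨ *-congˡ (trans (^-distrib-* _ _ c) (*-cong (^-assocʳ y (i ℕ.* cⁱ ℕ.* d) c) (trans (^-assocʳ (τ 1) cⁱ c) (^-congʳ (τ 1) (ℕP.*-comm cⁱ c))))) ⟩
      y ↑ (c ℕ.* cⁱ ℕ.* d) * (y ↑ (i ℕ.* cⁱ ℕ.* d ℕ.* c) * τ 1 ↑ (c ℕ.* cⁱ))   ≈⟨ *-assoc _ _ _ ⟨
      y ↑ (c ℕ.* cⁱ ℕ.* d) * y ↑ (i ℕ.* cⁱ ℕ.* d ℕ.* c) * τ 1 ↑ (c ℕ.* cⁱ)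
        ≈⟨ *-congʳ (trans (sym (^-homo-* y (c ℕ.* cⁱ ℕ.* d) _)) (^-congʳ y (arith c cⁱ d i))) ⟩
      y ↑ (suc i ℕ.* (c ℕ.* cⁱ) ℕ.* d) * τ 1 ↑ (c ℕ.* cⁱ)                     ∎
      where
      cⁱ = c ℕ.^ i
      arith : ∀ c a d i → c ℕ.* a ℕ.* d ℕ.+ i ℕ.* a ℕ.* d ℕ.* c ≡ suc i ℕ.* (c ℕ.* a) ℕ.* d
      arith = ℕSolver.solve-∀

    module _ (τ≉0 : ¬ τ 1 ≈ 0#) where
      h : ℕ
      h = proj₁ (power≋1 {r} {p} (prime-power-cancellable pl l∤p (suc K)))

      P : ℕ
      P = p ℕ.^ suc h

      P≋1 : P ≋ 1 ⟨ r ⟩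
      P≋1 = proj₂ (power≋1 {r} {p} (prime-power-cancellable pl l∤p (suc K)))

      1<P : 1 ℕ.< P
      1<P = ℕP.<-≤-trans (prime>1 pp) (ℕP.m≤m*n p (p ℕ.^ h) {{ℕP.m^n≢0 p h}})

      -- `τ` depends only on its index modulo r, and P ≡ 1 modulo r.
      τ-P^ : ∀ s → ∃ λ b → τ 1 ≈ y ↑ b * τ 1 ↑ (P ℕ.^ s)
      τ-P^ s = suc h ℕ.* s ℕ.* p ℕ.^ (suc h ℕ.* s) ℕ.* e p , (begin
        τ 1                       ≈⟨ τ-cong (≋-sym (≋-trans (^-≋ s P≋1) (≋-reflexive (ℕP.^-zeroˡ s)))) ⟩
        τ (P ℕ.^ s)               ≈⟨ reflexive (≡.cong τ (ℕP.^-*-assoc p (suc h) s)) ⟩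
        τ (p ℕ.^ (suc h ℕ.* s))   ≈⟨ equivariant-iterate l∤p (λ a _ → τ-frobenius a) (suc h ℕ.* s) ⟩
        _ * τ 1 ↑ (p ℕ.^ (suc h ℕ.* s))  ≈⟨ *-congˡ (^-congʳ (τ 1) (ℕP.^-*-assoc p (suc h) s)) ⟨
        _ * τ 1 ↑ (P ℕ.^ s)       ∎)

      τ-not-nilpotent : ∀ M → ¬ τ 1 ↑ M ≈ 0#
      τ-not-nilpotent M τᴹ≈0 = τ≉0 (begin
        τ 1                                     ≈⟨ proj₂ (τ-P^ M) ⟩
        _ * τ 1 ↑ (P ℕ.^ M)                     ≈⟨ *-congˡ (^-congʳ (τ 1) (≡.sym (ℕP.m+[n∸m]≡n (ℕP.<⇒≤ (n<m^n 1<P M))))) ⟩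
        _ * τ 1 ↑ (M ℕ.+ (P ℕ.^ M ∸ M))         ≈⟨ *-congˡ (^-homo-* (τ 1) M _) ⟩
        _ * (τ 1 ↑ M * τ 1 ↑ (P ℕ.^ M ∸ M))     ≈⟨ *-congˡ (trans (*-congʳ τᴹ≈0) (zeroˡ _)) ⟩
        _ * 0#                                  ≈⟨ zeroʳ _ ⟩
        0#                                      ∎)

      -- The ring has characteristic p and l ≠ p, so l is invertible modulo p.
      l-torsion-free : ∀ {z} → l · z ≈ 0# → z ≈ 0#
      l-torsion-free {z} lz≈0 with inverse-mod {p} {l} (prime-cancellable pp p∤l)
        where
        p∤l : ¬ p ∣ l
        p∤l p∣l with prime⇒irreducible pl p∣l
        ... | inj₁ p≡1 = ℕP.<⇒≢ (prime>1 pp) (≡.sym p≡1)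
        ... | inj₂ p≡l = l∤p (≡.subst (l ∣_) (≡.sym p≡l) ∣-refl)
      ... | l′ , via u v eq = begin
        z                                       ≈⟨ +-identityʳ z ⟨
        z + 0#                                  ≈⟨ +-cong (sym (+-identityʳ z)) (sym (p-multiple v)) ⟩
        1 · z + (v ℕ.* p) · z                   ≈⟨ ×-homo-+ z 1 (v ℕ.* p) ⟨
        (1 ℕ.+ v ℕ.* p) · z                     ≈⟨ ×-congˡ eq ⟨
        (l ℕ.* l′ ℕ.+ u ℕ.* p) · z              ≈⟨ ×-homo-+ z (l ℕ.* l′) (u ℕ.* p) ⟩
        (l ℕ.* l′) · z + (u ℕ.* p) · z          ≈⟨ +-cong (trans (×-congˡ (ℕP.*-comm l l′)) (sym (×-assocˡ z l′ l))) (p-multiple u) ⟩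
        l′ · (l · z) + 0#                       ≈⟨ trans (+-identityʳ _) (×-congʳ l′ lz≈0) ⟩
        l′ · 0#                                 ≈⟨ trans (sym (sum-replicate l′)) (sum-replicate-zero l′) ⟩
        0#                                      ∎
        where
        p-multiple : ∀ v → (v ℕ.* p) · z ≈ 0#
        p-multiple v = multiple≈0 pp p≈0 (divides v ≡.refl) z

      fixed-↑ : ∀ {w z} → w * z ≈ z → ∀ k → w ↑ k * z ≈ z
      fixed-↑ wz≈z zero    = *-identityˡ _
      fixed-↑ wz≈z (suc k) = trans (*-assoc _ _ _) (trans (*-congˡ (fixed-↑ wz≈z k)) wz≈z)

      -- Otherwise d = l^s·w with s ≤ K and l not dividing w, so y^(l^K) also fixes z = `τ 1 ↑ M`.
      -- Each summand of Φ_r(y) then fixes z, giving l·z = Φ_r(y)·z = 0 and making `τ 1` nilpotent.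
      r∣order : ∀ d M → y ↑ d * τ 1 ↑ M ≈ τ 1 ↑ M → r ∣ d
      r∣order zero      M _    = r ∣0
      r∣order d@(suc _) M dz≈z with split-power pl d ℕ.z<s
      ... | s , w , eq , l∤w with suc K ℕ.≤? s
      ...   | yes K<s = ≡.subst (r ∣_) (≡.sym eq) (∣-trans (^-mono-∣ l K<s) (m∣m*n w))
      ...   | no K≮s = contradiction (l-torsion-free lz≈0) (τ-not-nilpotent M)
        where
        z = τ 1 ↑ M
        w′ = proj₁ (inverse-mod {r} {w} (prime-power-cancellable pl l∤w (suc K)))
        ww′≋1 : w ℕ.* w′ ≋ 1 ⟨ r ⟩
        ww′≋1 = proj₂ (inverse-mod {r} {w} (prime-power-cancellable pl l∤w (suc K)))
        s≤K : s ℕ.≤ K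
        s≤K = ℕP.≤-pred (ℕP.≰⇒> K≮s)
        fixed-lˢ : y ↑ (l ℕ.^ s) * z ≈ z
        fixed-lˢ = begin
          y ↑ (l ℕ.^ s) * z           ≈⟨ *-congʳ (y-cong (≋-trans (≋-reflexive (≡.sym (ℕP.*-identityʳ (l ℕ.^ s))))
                                           (≋-trans (*-≋ʳ (l ℕ.^ s) (≋-sym ww′≋1)) (≋-reflexive (≡.trans (≡.sym (ℕP.*-assoc (l ℕ.^ s) w w′)) (≡.cong (ℕ._* w′) (≡.sym eq))))))) ⟩
          y ↑ (d ℕ.* w′) * z          ≈⟨ *-congʳ (^-assocʳ y d w′) ⟨
          (y ↑ d) ↑ w′ * z            ≈⟨ fixed-↑ dz≈z w′ ⟩
          z                           ∎
        fixed-lᴷ : y ↑ (l ℕ.^ K) * z ≈ z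
        fixed-lᴷ = begin
          y ↑ (l ℕ.^ K) * z                    ≈⟨ *-congʳ (^-congʳ y (≡.trans (≡.cong (l ℕ.^_) (≡.sym (ℕP.m+[n∸m]≡n s≤K))) (ℕP.^-distribˡ-+-* l s (K ∸ s)))) ⟩
          y ↑ (l ℕ.^ s ℕ.* l ℕ.^ (K ∸ s)) * z  ≈⟨ *-congʳ (^-assocʳ y (l ℕ.^ s) _) ⟨
          (y ↑ (l ℕ.^ s)) ↑ (l ℕ.^ (K ∸ s)) * z ≈⟨ fixed-↑ fixed-lˢ (l ℕ.^ (K ∸ s)) ⟩
          z                                    ∎
        lz≈0 : l · z ≈ 0#
        lz≈0 = begin
          l · z                                         ≈⟨ sum-replicate l ⟨
          ∑[ t < l ] z                                  ≈⟨ (sum-cong-≋ {l} λ t → trans (*-congʳ (trans (^-congʳ y (ℕP.*-comm (toℕ t) (l ℕ.^ K))) (sym (^-assocʳ y (l ℕ.^ K) (toℕ t))))) (fixed-↑ fixed-lᴷ (toℕ t))) ⟨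
          ∑[ t < l ] (y ↑ (toℕ t ℕ.* l ℕ.^ K) * z)      ≈⟨ *-distribʳ-sum {l} z (λ t → y ↑ (toℕ t ℕ.* l ℕ.^ K)) ⟨
          (∑[ t < l ] (y ↑ (toℕ t ℕ.* l ℕ.^ K))) * z    ≈⟨ trans (*-congʳ Φr≈0) (zeroˡ z) ⟩
          0#                                            ∎

      -- Reduces to `r∣order` by multiplying with y^(b·(r-1)), the inverse of y^b.
      y-faithful : ∀ a b M → y ↑ a * τ 1 ↑ M ≈ y ↑ b * τ 1 ↑ M → a ≋ b ⟨ r ⟩
      y-faithful a b M eq = ≋-trans (via b 0 (≡.trans (≡.cong (λ k → a ℕ.+ b ℕ.* k) (≡.sym (ℕP.suc-pred r))) (arith a b (ℕ.pred r))))
                                    (+-≋ (∣⇒≋0 (r∣order (b ℕ.* ℕ.pred r ℕ.+ a) M fixed)) (≋-refl {b}))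
        where
        arith : ∀ a b r → a ℕ.+ b ℕ.* suc r ≡ b ℕ.* r ℕ.+ a ℕ.+ b ℕ.+ 0
        arith = ℕSolver.solve-∀
        fixed : y ↑ (b ℕ.* ℕ.pred r ℕ.+ a) * τ 1 ↑ M ≈ τ 1 ↑ M
        fixed = begin
          y ↑ (b ℕ.* ℕ.pred r ℕ.+ a) * τ 1 ↑ M           ≈⟨ trans (*-congʳ (^-homo-* y (b ℕ.* ℕ.pred r) a)) (*-assoc _ _ _) ⟩
          y ↑ (b ℕ.* ℕ.pred r) * (y ↑ a * τ 1 ↑ M)       ≈⟨ *-congˡ eq ⟩
          y ↑ (b ℕ.* ℕ.pred r) * (y ↑ b * τ 1 ↑ M)       ≈⟨ trans (*-congʳ (^-homo-* y (b ℕ.* ℕ.pred r) b)) (*-assoc _ _ _) ⟨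
          y ↑ (b ℕ.* ℕ.pred r ℕ.+ b) * τ 1 ↑ M           ≈⟨ *-congʳ (y-cong (∣⇒≋0 (divides b (≡.trans (≡.trans (ℕP.+-comm _ b) (≡.sym (ℕP.*-suc b (ℕ.pred r)))) (≡.cong (b ℕ.*_) (ℕP.suc-pred r)))))) ⟩
          1# * τ 1 ↑ M                                   ≈⟨ *-identityˡ _ ⟩
          τ 1 ↑ M                                        ∎

      -- The r-th power of τ_1 = ζ·τ_1^P removes the root of unity and leaves τ_1^r = τ_1^(rP) =
      -- τ_1^(r+W). Hence W is a period of the powers of `τ 1` from the exponent r on.
      W : ℕ
      W = r ℕ.* (P ∸ 1)

      τ-W : ∀ s → τ 1 ↑ (r ℕ.+ s ℕ.* W) ≈ τ 1 ↑ r
      τ-W zero    = ^-congʳ (τ 1) (ℕP.+-identityʳ r)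
      τ-W (suc s) = begin
        τ 1 ↑ (r ℕ.+ (W ℕ.+ s ℕ.* W))           ≈⟨ ^-congʳ (τ 1) (≡.sym (ℕP.+-assoc r W _)) ⟩
        τ 1 ↑ (r ℕ.+ W ℕ.+ s ℕ.* W)             ≈⟨ ^-homo-* (τ 1) (r ℕ.+ W) (s ℕ.* W) ⟩
        τ 1 ↑ (r ℕ.+ W) * τ 1 ↑ (s ℕ.* W)       ≈⟨ *-congʳ base ⟩
        τ 1 ↑ r * τ 1 ↑ (s ℕ.* W)               ≈⟨ ^-homo-* (τ 1) r (s ℕ.* W) ⟨
        τ 1 ↑ (r ℕ.+ s ℕ.* W)                   ≈⟨ τ-W s ⟩
        τ 1 ↑ r                                 ∎
        where
        b = proj₁ (τ-P^ 1)
        base : τ 1 ↑ (r ℕ.+ W) ≈ τ 1 ↑ r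
        base = sym (begin
          τ 1 ↑ r                            ≈⟨ ^-congˡ r (proj₂ (τ-P^ 1)) ⟩
          (y ↑ b * τ 1 ↑ (P ℕ.^ 1)) ↑ r      ≈⟨ ^-distrib-* _ _ r ⟩
          (y ↑ b) ↑ r * (τ 1 ↑ (P ℕ.^ 1)) ↑ r ≈⟨ *-cong (root-of-unity-↑ {y} {r} y^r≈1 b) (^-assocʳ (τ 1) (P ℕ.^ 1) r) ⟩
          1# * τ 1 ↑ (P ℕ.^ 1 ℕ.* r)         ≈⟨ *-identityˡ _ ⟩
          τ 1 ↑ (P ℕ.^ 1 ℕ.* r)              ≈⟨ ^-congʳ (τ 1) (≡.trans (≡.cong (ℕ._* r) (≡.trans (ℕP.*-identityʳ P) (≡.sym (ℕP.m+[n∸m]≡n (ℕP.<⇒≤ 1<P))))) (≡.cong (λ k → r ℕ.+ k) (ℕP.*-comm (P ∸ 1) r))) ⟩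
          τ 1 ↑ (r ℕ.+ W)                    ∎)

      τ-mod-W : ∀ {a b} → a ≋ b ⟨ W ⟩ → τ 1 ↑ (r ℕ.+ a) ≈ τ 1 ↑ (r ℕ.+ b)
      τ-mod-W {a} {b} (via u v eq) = trans (sym (drop a u)) (trans (^-congʳ (τ 1) (≡.cong (λ k → r ℕ.+ k) eq)) (drop b v))
        where
        drop : ∀ a u → τ 1 ↑ (r ℕ.+ (a ℕ.+ u ℕ.* W)) ≈ τ 1 ↑ (r ℕ.+ a)
        drop a u = begin
          τ 1 ↑ (r ℕ.+ (a ℕ.+ u ℕ.* W))       ≈⟨ ^-congʳ (τ 1) (arith r a (u ℕ.* W)) ⟩
          τ 1 ↑ (r ℕ.+ u ℕ.* W ℕ.+ a)         ≈⟨ ^-homo-* (τ 1) (r ℕ.+ u ℕ.* W) a ⟩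
          τ 1 ↑ (r ℕ.+ u ℕ.* W) * τ 1 ↑ a     ≈⟨ *-congʳ (τ-W u) ⟩
          τ 1 ↑ r * τ 1 ↑ a                   ≈⟨ ^-homo-* (τ 1) r a ⟨
          τ 1 ↑ (r ℕ.+ a)                     ∎
          where
          arith : ∀ r a b → r ℕ.+ (a ℕ.+ b) ≡ r ℕ.+ b ℕ.+ a
          arith = ℕSolver.solve-∀

      -- Compare the iterates at A = n^((l−1)m) and B = p^(l−1). Since τ 1 ↑ W acts as 1 on τ 1 ↑ r and W = l^t u with l ∤ u,
      -- raising to the power u and using A ≡ B modulo l^t eliminates τ 1.
      exponent-p : ∃ λ N₀ → ∀ {n j′ N m} → ¬ l ∣ n → Equivariant n j′ → N₀ ℕ.≤ N →
        p ℕ.^ (l ∸ 1) ≋ n ℕ.^ ((l ∸ 1) ℕ.* m) ⟨ l ℕ.^ N ⟩ → e p ≋ m ℕ.* j′ ⟨ r ⟩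
      exponent-p with split-power pl W (ℕP.≤-trans (ℕP.m<n⇒0<n∸m 1<P) (ℕP.m≤n*m (P ∸ 1) r))
      -- The summand suc K gives A ≡ B modulo r, hence `τ A` = `τ B`; the summand t gives A·u ≡ B·u
      -- modulo W. The bound does not involve `m`, which is chosen afterwards.
      ... | t , u , W≡ , l∤u = suc K ℕ.+ t , λ {n} {j′} {N} {m} → main {n} {j′} {N} {m}
        where
        main : ∀ {n j′ N m} → ¬ l ∣ n → Equivariant n j′ → suc K ℕ.+ t ℕ.≤ N →
               p ℕ.^ (l ∸ 1) ≋ n ℕ.^ ((l ∸ 1) ℕ.* m) ⟨ l ℕ.^ N ⟩ → e p ≋ m ℕ.* j′ ⟨ r ⟩
        main {n} {j′} {N} {m} l∤n equi N₀≤N B≋A = ≋-sym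
          -- The comparison carries the common factor (l-1)·B·u, once A is replaced by B modulo r;
          -- all three factors are prime to l.
          (cancel-≋ {c = l ∸ 1} (prime-power-cancellable pl (∤-∸1 pl) (suc K))
          (cancel-≋ {c = B} (prime-power-cancellable pl (∤-^ pl l∤p (l ∸ 1)) (suc K))
          (cancel-≋ {c = u} (prime-power-cancellable pl l∤u (suc K)) exponents)))
          where
          A = n ℕ.^ ((l ∸ 1) ℕ.* m)
          B = p ℕ.^ (l ∸ 1)
          a = (l ∸ 1) ℕ.* m ℕ.* A ℕ.* j′
          b = (l ∸ 1) ℕ.* B ℕ.* e p
          B≋A-r : B ≋ A ⟨ r ⟩
          B≋A-r = ≋-∣ (^-mono-∣ l (ℕP.≤-trans (ℕP.m≤m+n (suc K) t) N₀≤N)) B≋A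
          uA≋uB : A ℕ.* u ≋ B ℕ.* u ⟨ W ⟩
          uA≋uB = scale (≋-∣ (^-mono-∣ l (ℕP.≤-trans (ℕP.m≤n+m t (suc K)) N₀≤N)) (≋-sym B≋A))
            where
            scale : A ≋ B ⟨ l ℕ.^ t ⟩ → A ℕ.* u ≋ B ℕ.* u ⟨ W ⟩
            scale (via v v′ eq) = via v v′ (≡.trans (side A v) (≡.trans (≡.cong (ℕ._* u) eq) (≡.sym (side B v′))))
              where
              side : ∀ A v → A ℕ.* u ℕ.+ v ℕ.* W ≡ (A ℕ.+ v ℕ.* l ℕ.^ t) ℕ.* u
              side A v = ≡.trans (≡.cong (λ W → A ℕ.* u ℕ.+ v ℕ.* W) W≡) (arith A v (l ℕ.^ t) u)
                where
                arith : ∀ A v b u → A ℕ.* u ℕ.+ v ℕ.* (b ℕ.* u) ≡ (A ℕ.+ v ℕ.* b) ℕ.* u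
                arith = ℕSolver.solve-∀
          τᴬ≈τᴮ : y ↑ a * τ 1 ↑ A ≈ y ↑ b * τ 1 ↑ B
          τᴬ≈τᴮ = begin
            y ↑ a * τ 1 ↑ A   ≈⟨ equivariant-iterate l∤n equi ((l ∸ 1) ℕ.* m) ⟨
            τ A               ≈⟨ τ-cong (≋-sym B≋A-r) ⟩
            τ B               ≈⟨ equivariant-iterate l∤p (λ a _ → τ-frobenius a) (l ∸ 1) ⟩
            y ↑ b * τ 1 ↑ B   ∎
          expand : ∀ a A → (y ↑ a * τ 1 ↑ A) ↑ u * τ 1 ↑ r ≈ y ↑ (a ℕ.* u) * τ 1 ↑ (r ℕ.+ A ℕ.* u)
          expand a A = begin
            (y ↑ a * τ 1 ↑ A) ↑ u * τ 1 ↑ r                ≈⟨ *-congʳ (trans (^-distrib-* _ _ u) (*-cong (^-assocʳ y a u) (^-assocʳ (τ 1) A u))) ⟩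
            y ↑ (a ℕ.* u) * τ 1 ↑ (A ℕ.* u) * τ 1 ↑ r      ≈⟨ *-assoc _ _ _ ⟩
            y ↑ (a ℕ.* u) * (τ 1 ↑ (A ℕ.* u) * τ 1 ↑ r)    ≈⟨ *-congˡ (trans (*-comm _ _) (sym (^-homo-* (τ 1) r (A ℕ.* u)))) ⟩
            y ↑ (a ℕ.* u) * τ 1 ↑ (r ℕ.+ A ℕ.* u)          ∎
          au≋bu : a ℕ.* u ≋ b ℕ.* u ⟨ r ⟩
          au≋bu = y-faithful (a ℕ.* u) (b ℕ.* u) (r ℕ.+ A ℕ.* u) (begin
            y ↑ (a ℕ.* u) * τ 1 ↑ (r ℕ.+ A ℕ.* u)     ≈⟨ expand a A ⟨
            (y ↑ a * τ 1 ↑ A) ↑ u * τ 1 ↑ r           ≈⟨ *-congʳ (^-congˡ u τᴬ≈τᴮ) ⟩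
            (y ↑ b * τ 1 ↑ B) ↑ u * τ 1 ↑ r           ≈⟨ expand b B ⟩
            y ↑ (b ℕ.* u) * τ 1 ↑ (r ℕ.+ B ℕ.* u)     ≈⟨ *-congˡ (τ-mod-W (≋-sym uA≋uB)) ⟩
            y ↑ (b ℕ.* u) * τ 1 ↑ (r ℕ.+ A ℕ.* u)     ∎)
          exponents : u ℕ.* (B ℕ.* ((l ∸ 1) ℕ.* (m ℕ.* j′))) ≋ u ℕ.* (B ℕ.* ((l ∸ 1) ℕ.* e p)) ⟨ r ⟩
          exponents = ≋-trans (*-≋ʳ u (*-≋ˡ B≋A-r)) (≋-trans (≋-reflexive (arith₁ u A (l ∸ 1) m j′))
            (≋-trans au≋bu (≋-reflexive (arith₂ u B (l ∸ 1) (e p)))))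
            where
            arith₁ : ∀ u A k m j → u ℕ.* (A ℕ.* (k ℕ.* (m ℕ.* j))) ≡ k ℕ.* m ℕ.* A ℕ.* j ℕ.* u
            arith₁ = ℕSolver.solve-∀
            arith₂ : ∀ u B k e → k ℕ.* B ℕ.* e ℕ.* u ≡ u ℕ.* (B ℕ.* (k ℕ.* e))
            arith₂ = ℕSolver.solve-∀

-- Passing from the prime factors to n, and the conclusion

^-distribʳ-* : ∀ k a b → (a ℕ.* b) ℕ.^ k ≡ a ℕ.^ k ℕ.* b ℕ.^ k
^-distribʳ-* zero    a b = ≡.refl
^-distribʳ-* (suc k) a b = ≡.trans (≡.cong (a ℕ.* b ℕ.*_) (^-distribʳ-* k a b)) (interchange a b (a ℕ.^ k) (b ℕ.^ k))
  where open import Algebra.Properties.CommutativeSemigroup ℕP.*-commutativeSemigroup using (interchange)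

approx-≋ : ∀ {l} (λ′ : ℤ_ l) K i → approx λ′ (K ℕ.+ i) ≋ approx λ′ K ⟨ l ℕ.^ K ⟩
approx-≋ λ′ K zero = ≋-reflexive (≡.cong (approx λ′) (ℕP.+-identityʳ K))
approx-≋ {l} λ′ K (suc i) = ≋-trans (≋-reflexive (≡.cong (approx λ′) (ℕP.+-suc K i)))
  (≋-trans (≋-∣ (^-mono-∣ l (ℕP.m≤m+n K i)) (fromℤ (compat λ′ (K ℕ.+ i)))) (approx-≋ λ′ K i))

approx-≋-≤ : ∀ {l} (λ′ : ℤ_ l) {K N} → K ℕ.≤ N → approx λ′ N ≋ approx λ′ K ⟨ l ℕ.^ K ⟩
approx-≋-≤ λ′ {K} {N} K≤N = ≋-trans (≋-reflexive (≡.cong (approx λ′) (≡.sym (ℕP.m+[n∸m]≡n K≤N)))) (approx-≋ λ′ K (N ∸ K))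

module _ {n q l K : ℕ} (pq : Prime q) (q∤n : ¬ q ∣ n) (pl : Prime l) (l∤n : ¬ l ∣ n)
         (χ : Character q (l ℕ.^ suc K)) where

  private
    r = l ℕ.^ suc K
    instance
      _ = prime⇒nonZero pq
      _ = prime⇒nonZero pl
      _ = ℕP.m^n≢0 l (suc K)
    open Character χ using (exp)

  exp-cong : ∀ {a b} → a ≋ b ⟨ q ⟩ → exp a ≋ exp b ⟨ r ⟩
  exp-cong {a} {b} a≋b = fromℤ (Character.periodic χ a b (toℤ a≋b))

  exp-* : ∀ a b → ¬ q ∣ a → ¬ q ∣ b → exp (a ℕ.* b) ≋ exp a ℕ.+ exp b ⟨ r ⟩
  exp-* a b q∤a q∤b = fromℤ (Character.mult χ a b q∤a q∤b)

  exp-1 : exp 1 ≋ 0 ⟨ r ⟩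
  exp-1 with exp-* 1 1 q∤1 q∤1
    where
    q∤1 : ¬ q ∣ 1
    q∤1 d = ℕP.<⇒≢ (prime>1 pq) (≡.sym (∣1⇒≡1 d))
  ... | via u v eq = via v u (≡.sym (ℕP.+-cancelˡ-≡ (exp 1) _ _ (≡.trans eq (ℕP.+-assoc (exp 1) (exp 1) (v ℕ.* r)))))

  module _ {j : ℕ} (cong : CongCyc n q l (suc K) (σ n (gauss q r χ)) (mon 0 j ⊗ (gauss q r χ ^ᴳ n))) where

    -- Frobenius produces χ(p)^p, whereas hypothesis (2) produces ζ_r^j. Writing j ≡ n·j' gives both
    -- the same form, so that j' is what must be matched with the exponent of χ(n).
    j′ : ℕ
    j′ = proj₁ (inverse-mod {r} {n} (prime-power-cancellable pl l∤n (suc K))) ℕ.* j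

    nj′≋j : n ℕ.* j′ ≋ j ⟨ r ⟩
    nj′≋j = ≋-trans (≋-reflexive (≡.sym (ℕP.*-assoc n _ j)))
      (≋-trans (*-≋ˡ (proj₂ (inverse-mod {r} {n} (prime-power-cancellable pl l∤n (suc K))))) (≋-reflexive (ℕP.*-identityˡ j)))

    module _ {p : ℕ} (pp : Prime p) (p∣n : p ∣ n) where
      open Model p q l K pp pq pl hiding (r)
      open CommutativeRing shiftRing hiding (zero)
      open Powers shiftRing
      open FiniteSums +-commutativeMonoid
      open CyclotomicEvaluation shiftRing con-homomorphism q l K X
      open GaussSums shiftRing using (module AtRoots)
      open AtRoots {p} {q} {l} {K} pp pq pl (λ d → q∤n (∣-trans d p∣n)) (λ d → l∤n (∣-trans d p∣n))
        p≈0 X Y X^q≈1 Y^r≈1 ΦY≈0 exp exp-cong exp-* hiding (r)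
      open import Relation.Binary.Reasoning.Setoid setoid

      n≈0 : con (ℤ.+ n) ≈ 0#
      n≈0 = trans (reflexive (≡.cong (con ∘ ℤ.+_) (_∣_.equality p∣n))) (con-multiple (_∣_.quotient p∣n))

      -- Up to Y^r = 1, the exponent t·r/l depends only on t modulo l, and t ↦ a·t permutes these
      -- residues. So Φ_r(Y^a) and Φ_r(Y) have the same summands.
      ΦYᵃ≈0 : ∀ a → ¬ l ∣ a → ∑[ t < l ] ((Y ↑ a) ↑ (toℕ t ℕ.* l ℕ.^ K)) ≈ 0#
      ΦYᵃ≈0 a l∤a = begin
        ∑[ t < l ] ((Y ↑ a) ↑ (toℕ t ℕ.* l ℕ.^ K))
          ≈⟨ (sum-cong-≋ {l} λ t → trans (^-assocʳ Y a _) (^-congʳ Y (≡.sym (ℕP.*-assoc a (toℕ t) (l ℕ.^ K))))) ⟩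
        ∑[ t < l ] (Y ↑ (a ℕ.* toℕ t ℕ.* l ℕ.^ K))
          ≈⟨ sum-reindex {l} {a} {λ t → Y ↑ (t ℕ.* l ℕ.^ K)} (prime-cancellable pl l∤a) periodic ⟩
        ∑[ t < l ] (Y ↑ (toℕ t ℕ.* l ℕ.^ K))
          ≈⟨ ΦY≈0 ⟩
        0# ∎
        where
        arith : ∀ a u l k → (a ℕ.+ u ℕ.* l) ℕ.* k ≡ a ℕ.* k ℕ.+ u ℕ.* (l ℕ.* k)
        arith = ℕSolver.solve-∀
        periodic : Periodic l (λ t → Y ↑ (t ℕ.* l ℕ.^ K))
        periodic {a} {b} (via u v eq) = y-cong (via u v (≡.trans (≡.sym (arith a u l (l ℕ.^ K)))
          (≡.trans (≡.cong (ℕ._* l ℕ.^ K) eq) (arith b v l (l ℕ.^ K)))))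

      ev-gauss-τ : ∀ {z} a → z ≈ Y ↑ a → ev z (gauss q r χ) ≈ τ a
      ev-gauss-τ {z} a z≈Yᵃ = trans (ev-gauss X^q≈1 (trans (^-congˡ r z≈Yᵃ) (root-of-unity-↑ {Y} {r} Y^r≈1 a)) χ)
        (-‿cong (sum-cong-≋ {q} λ m → go (toℕ m)))
        where
        go : ∀ m → (if eqmod q m 0 then 0# else X ↑ m * z ↑ exp m) ≈ term a m
        go m with eqmod q m 0
        ... | true  = refl
        ... | false = *-congˡ (trans (^-congˡ (exp m) z≈Yᵃ) (^-assocʳ Y a (exp m)))

      -- Evaluating hypothesis (2) at Y^a is its conjugate under ζ_r ↦ ζ_r^a.
      equivariant-n : Equivariant n j′
      equivariant-n a l∤a = begin
        τ (n ℕ.* a)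
          ≈⟨ ev-gauss-τ (n ℕ.* a) (trans (^-assocʳ Y a n) (^-congʳ Y (ℕP.*-comm a n))) ⟨
        ev ((Y ↑ a) ↑ n) G
          ≈⟨ ev-σ X^q≈1 Yᵃ n G ⟨
        ev (Y ↑ a) (σ n G)
          ≈⟨ ev-CongCyc X^q≈1 ΦX≈0 Yᵃ (ΦYᵃ≈0 a l∤a) {n} n≈0 cong ⟩
        ev (Y ↑ a) (mon 0 j ⊗ (G ^ᴳ n))
          ≈⟨ ev-⊗ X^q≈1 Yᵃ (mon 0 j) (G ^ᴳ n) ⟩
        ev (Y ↑ a) (mon 0 j) * ev (Y ↑ a) (G ^ᴳ n)
          ≈⟨ *-cong (trans (ev-mon X^q≈1 Yᵃ 0 j) (*-identityˡ _)) (trans (ev-^ X^q≈1 Yᵃ G n) (^-congˡ n (ev-gauss-τ a refl))) ⟩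
        (Y ↑ a) ↑ j * τ a ↑ n
          ≈⟨ *-congʳ (trans (^-assocʳ Y a j) (y-cong (≋-trans (*-≋ʳ a (≋-sym nj′≋j)) (≋-reflexive (arith a n j′))))) ⟩
        Y ↑ (n ℕ.* a ℕ.* j′) * τ a ↑ n ∎
        where
        G = gauss q r χ
        Yᵃ : (Y ↑ a) ↑ r ≈ 1#
        Yᵃ = root-of-unity-↑ {Y} {r} Y^r≈1 a
        arith : ∀ a n j → a ℕ.* (n ℕ.* j) ≡ n ℕ.* a ℕ.* j
        arith = ℕSolver.solve-∀

      τ≉0 : ¬ τ 1 ≈ 0#
      τ≉0 τ≈0 = gauss-sum≉0 (λ m → 1 ℕ.* exp m) (trans (sym (-‿involutive _)) (trans (-‿cong τ≈0) -0#≈0#))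
        where open import Algebra.Properties.Ring ring using (-‿involutive; -0#≈0#)

      -- Comparing the powers of τ_1 takes a fine approximation of λ_p, but the resulting exponent
      -- only sees it modulo r.
      exponent-approx : (λ′ : ℤ_ l) → LadicPowEq l p n λ′ → exp p ≋ approx λ′ (suc K) ℕ.* j′ ⟨ r ⟩
      exponent-approx λ′ p≡nλ = ≋-trans
        (proj₂ (exponent-p τ≉0) {n} {j′} {N} {approx λ′ N} l∤n equivariant-n (ℕP.m≤m+n N₀ (suc K)) (fromℤ {p ℕ.^ (l ∸ 1)} {n ℕ.^ ((l ∸ 1) ℕ.* approx λ′ N)} (p≡nλ N)))
        (*-≋ˡ (approx-≋-≤ λ′ (ℕP.m≤n+m (suc K) N₀)))
        where
        N₀ = proj₁ (exponent-p τ≉0)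
        N = N₀ ℕ.+ suc K

    module _ (λp : (p : ℕ) → Prime p → p ∣ n → ℤ_ l)
             (p≡nλ : (p : ℕ) (pp : Prime p) (pn : p ∣ n) → LadicPowEq l p n (λp p pp pn)) where

      -- S adds up level-k approximations, one for each prime factor with multiplicity. A single S
      -- must serve both moduli, and k ≥ K + 1 ensures that level k determines λ_p modulo r.
      exp-product : ∀ {k} → suc K ℕ.≤ k → ∀ ps → All Prime ps → product ps ∣ n → ∃ λ S →
        exp (product ps) ≋ S ℕ.* j′ ⟨ r ⟩ × product ps ℕ.^ (l ∸ 1) ≋ n ℕ.^ ((l ∸ 1) ℕ.* S) ⟨ l ℕ.^ k ⟩
      exp-product K<k [] [] _ = 0 , exp-1 ,
        ≋-reflexive (≡.trans (ℕP.^-zeroˡ (l ∸ 1)) (≡.cong (n ℕ.^_) (≡.sym (ℕP.*-zeroʳ (l ∸ 1)))))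
      exp-product {k} K<k (p ∷ ps) (pp ∷ pps) pps∣n with exp-product K<k ps pps (∣-trans (n∣m*n p) pps∣n)
      ... | S , e , f = approx λ′ k ℕ.+ S
        , ≋-trans (exp-* p (product ps) (λ d → q∤n (∣-trans d p∣n)) (λ d → q∤n (∣-trans d (∣-trans (n∣m*n p) pps∣n))))
            (≋-trans (+-≋ (≋-trans (exponent-approx pp p∣n λ′ (p≡nλ p pp p∣n)) (*-≋ˡ (≋-sym (approx-≋-≤ λ′ K<k)))) e)
              (≋-reflexive (≡.sym (ℕP.*-distribʳ-+ j′ (approx λ′ k) S))))
        , ≋-trans (≋-reflexive (^-distribʳ-* (l ∸ 1) p (product ps)))
            (≋-trans (*-≋ (fromℤ {p ℕ.^ (l ∸ 1)} {n ℕ.^ ((l ∸ 1) ℕ.* approx λ′ k)} (p≡nλ p pp p∣n k)) f)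
              (≋-reflexive (≡.sym (≡.trans (≡.cong (n ℕ.^_) (ℕP.*-distribˡ-+ (l ∸ 1) (approx λ′ k) S))
                (ℕP.^-distribˡ-+-* n ((l ∸ 1) ℕ.* approx λ′ k) _)))))
        where
        p∣n = ∣-trans (m∣m*n (product ps)) pps∣n
        λ′ = λp p pp p∣n

      j′≋exp-n : 1 ℕ.< n → j′ ≋ exp n ⟨ r ⟩
      j′≋exp-n 1<n with fixed-power pl (∤-^ pl l∤n (l ∸ 1)) 1<g (suc K)
        where
        1<g : 1 ℕ.< n ℕ.^ (l ∸ 1)
        1<g = ℕP.<-≤-trans 1<n (ℕP.≤-trans (ℕP.≤-reflexive (≡.sym (ℕP.*-identityʳ n)))
          (ℕP.^-monoʳ-≤ n {{ℕ.>-nonZero (ℕP.<⇒≤ 1<n)}} {1} (ℕP.m<n⇒0<n∸m (prime>1 pl))))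
      ... | k , K<k , fixed = ≋-sym (conclude (factorise n {{ℕ.>-nonZero (ℕP.<⇒≤ 1<n)}}))
        where
        conclude : PrimeFactorisation n → exp n ≋ j′ ⟨ r ⟩
        conclude f with exp-product K<k factors factorsPrime (≡.subst (_∣ n) isFactorisation ∣-refl)
          where open PrimeFactorisation f
        ... | S , e≋ , pow≋ = ≋-trans (≋-trans (≋-reflexive (≡.cong exp isFactorisation)) e≋) (≋-trans (*-≋ˡ S≋1) (≋-reflexive (ℕP.*-identityˡ j′)))
          where
          open PrimeFactorisation f
          S≋1 : S ≋ 1 ⟨ r ⟩
          S≋1 = fixed S (≋-sym (≋-trans (≋-reflexive (≡.cong (ℕ._^ (l ∸ 1)) isFactorisation))
            (≋-trans pow≋ (≋-reflexive (≡.sym (ℕP.^-*-assoc n (l ∸ 1) S))))))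

      exp-at-prime : ∀ p (pp : Prime p) (pn : p ∣ n) → exp p ≋ approx (λp p pp pn) (suc K) ℕ.* exp n ⟨ r ⟩
      exp-at-prime p pp pn = ≋-trans (exponent-approx pp pn (λp p pp pn) (p≡nλ p pp pn)) (*-≋ʳ (approx (λp p pp pn) (suc K)) (j′≋exp-n 1<n))
        where
        n≢0 : n ≢ 0
        n≢0 ≡.refl = q∤n (q ∣0)
        1<n : 1 ℕ.< n
        1<n = ℕP.<-≤-trans (prime>1 pp) (∣⇒≤ {{ℕ.≢-nonZero n≢0}} pn)

open import Data.Integer using (+_)
open import Data.Nat using (_^_; _*_)

theorem3p2 : (n q l K : ℕ) → Prime q → ¬ (q ∣ n) → Prime l → ¬ (l ∣ n) →
    (χ : Character q (l ^ K)) →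
    (λp : (p : ℕ) → Prime p → p ∣ n → ℤ_ l) →
    ((p : ℕ) (pp : Prime p) (pn : p ∣ n) → LadicPowEq l p n (λp p pp pn)) →
    (∃ λ j → CongCyc n q l K (σ n (gauss q (l ^ K) χ)) (mon 0 j ⊗ (gauss q (l ^ K) χ ^ᴳ n))) →
    (p : ℕ) (pp : Prime p) (pn : p ∣ n) →
    (+ Character.exp χ p) ≡ (+ (approx (λp p pp pn) K * Character.exp χ n)) [mod l ^ K ]
-- Here r = 1 and the claim is a congruence modulo 1; the general case uses the exponent r/l.
theorem3p2 n q l zero    pq q∤n pl l∤n χ λp p≡nλ (j , cong) p pp pn = 1∣ _
theorem3p2 n q l (suc K) pq q∤n pl l∤n χ λp p≡nλ (j , cong) p pp pn =
  toℤ (exp-at-prime {n} {q} {l} {K} pq q∤n pl l∤n χ {j} cong λp p≡nλ p pp pn)
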